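{- Let $k\ge 4$ be an integer and let $\alpha_1,\ldots,\alpha_k$ be the (complex) roots of $f_k(X)=X^k-X^{k-1}-\cdots-X-1$. Then $$|\alpha_i-\alpha_j|>\frac{1}{k^{6.6}\,(\pi/e)^{k}}\qquad\text{for all }1\le i<j\le k.$$
   Context: $f_k(X)=X^k-X^{k-1}-\cdots-X-1$ is the characteristic polynomial of the $k$-generalized Fibonacci sequence; its roots are distinct. -}

module Defs where

open import Algebra.Bundles.Raw using (RawRing)
open import Data.Fin using (Fin; toℕ)
open import Data.Integer as ℤ using (ℤ; +_)
import Data.Integer.Properties as ℤₚ
import Data.Integer.Solver as ℤSolver
open import Data.Nat as ℕ using (ℕ; zero; suc; z≤n; s≤s; _!)
import Data.Nat.Properties as ℕₚ
open import Data.Product using (∃; _×_; _,_; proj₁; proj₂)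
open import Data.Rational as ℚ using (ℚ; 0ℚ; 1ℚ; ½; ∣_∣; _/_)
open import Data.Rational.Properties as ℚₚ
  using (module ≤-Reasoning; ≤-trans; <-trans; <-≤-trans; ≤-<-trans; <⇒≤)
open import Data.Rational.Solver using (module +-*-Solver)
open import Data.Rational.Unnormalised as ℚᵘ using (mkℚᵘ; *≡*)
import Data.Rational.Unnormalised.Properties as ℚᵘₚ
open import Data.Sum using (inj₁; inj₂; [_,_]′)
open import Function using (_∘_)
open import Level using (0ℓ)
open import Relation.Nullary using (¬_; Dec; yes; no; contradiction)
open import Relation.Binary.PropositionalEquality
  using (_≡_; refl; sym; trans; cong; cong₂; subst; subst₂)

import Algebra.Definitions.RawSemiring as RawSemiringDefs
open RawSemiringDefs ℚ.+-*-rawSemiring using (_^_)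
open ℤSolver.+-*-Solver using ()
  renaming (solve to ℤ-solve; _:=_ to _ℤ:=_; _:+_ to _ℤ:+_; _:*_ to _ℤ:*_; con to ℤcon)
open +-*-Solver using (solve; _:=_; _:+_; _:*_; _:-_; :-_; con)

private
  variable
    a b c d p q ε : ℚ
    n : ℕ

  Seq : Set
  Seq = ℕ → ℚ

-- Total, with the junk value 0 at 0: the terms of a positive real are nonzero
-- from some index on.
recip : ℚ → ℚ
recip p with p ℚ.≟ 0ℚ
... | yes _  = 0ℚ
... | no p≢0 = (ℚ.1/ p) {{ℚ.≢-nonZero p≢0}}

abstract

  0≤1 : 0ℚ ℚ.≤ 1ℚ
  0≤1 = ℚₚ.nonNegative⁻¹ 1ℚ

  0<1 : 0ℚ ℚ.< 1ℚ
  0<1 = ℚₚ.positive⁻¹ 1ℚ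

  +-pos : 0ℚ ℚ.< p → 0ℚ ℚ.< q → 0ℚ ℚ.< p ℚ.+ q
  +-pos {p} {q} 0<p 0<q = subst (ℚ._< p ℚ.+ q) (ℚₚ.+-identityˡ 0ℚ) (ℚₚ.+-mono-< 0<p 0<q)

  +-nonNeg : 0ℚ ℚ.≤ p → 0ℚ ℚ.≤ q → 0ℚ ℚ.≤ p ℚ.+ q
  +-nonNeg {p} {q} 0≤p 0≤q = subst (ℚ._≤ p ℚ.+ q) (ℚₚ.+-identityˡ 0ℚ) (ℚₚ.+-mono-≤ 0≤p 0≤q)

  *-monoˡ : 0ℚ ℚ.≤ a → p ℚ.≤ q → a ℚ.* p ℚ.≤ a ℚ.* q
  *-monoˡ {a} 0≤a = ℚₚ.*-monoˡ-≤-nonNeg a {{ℚ.nonNegative 0≤a}}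

  *-monoˡ-< : 0ℚ ℚ.< a → p ℚ.< q → a ℚ.* p ℚ.< a ℚ.* q
  *-monoˡ-< {a} 0<a = ℚₚ.*-monoʳ-<-pos a {{ℚ.positive 0<a}}

  *-mono : 0ℚ ℚ.≤ a → a ℚ.≤ b → 0ℚ ℚ.≤ c → c ℚ.≤ d → a ℚ.* c ℚ.≤ b ℚ.* d
  *-mono {a} {b} {c} {d} 0≤a a≤b 0≤c c≤d = ≤-trans (*-monoˡ 0≤a c≤d)
    (subst₂ ℚ._≤_ (ℚₚ.*-comm d a) (ℚₚ.*-comm d b) (*-monoˡ (≤-trans 0≤c c≤d) a≤b))

  *-nonNeg : 0ℚ ℚ.≤ p → 0ℚ ℚ.≤ q → 0ℚ ℚ.≤ p ℚ.* q
  *-nonNeg {p} {q} 0≤p 0≤q = subst (ℚ._≤ p ℚ.* q) (ℚₚ.*-zeroʳ p) (*-monoˡ 0≤p 0≤q)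

  *-pos : 0ℚ ℚ.< p → 0ℚ ℚ.< q → 0ℚ ℚ.< p ℚ.* q
  *-pos {p} {q} 0<p 0<q = subst (ℚ._< p ℚ.* q) (ℚₚ.*-zeroʳ p) (*-monoˡ-< 0<p 0<q)

  0<½* : 0ℚ ℚ.< ε → 0ℚ ℚ.< ½ ℚ.* ε
  0<½* = *-pos (ℚₚ.positive⁻¹ ½)

  halves : ∀ ε → ½ ℚ.* ε ℚ.+ ½ ℚ.* ε ≡ ε
  halves = solve 1 (λ x → con ½ :* x :+ con ½ :* x := x) refl

  ^-nonNeg : ∀ n → 0ℚ ℚ.≤ p → 0ℚ ℚ.≤ p ^ n
  ^-nonNeg zero    _   = 0≤1
  ^-nonNeg (suc n) 0≤p = *-nonNeg 0≤p (^-nonNeg n 0≤p)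

  ^-pos : ∀ n → 0ℚ ℚ.< p → 0ℚ ℚ.< p ^ n
  ^-pos zero    _   = 0<1
  ^-pos (suc n) 0<p = *-pos 0<p (^-pos n 0<p)

  ^-mono : ∀ n → 0ℚ ℚ.≤ p → p ℚ.≤ q → p ^ n ℚ.≤ q ^ n
  ^-mono zero    _   _   = ℚₚ.≤-refl
  ^-mono (suc n) 0≤p p≤q = *-mono 0≤p p≤q (^-nonNeg n 0≤p) (^-mono n 0≤p p≤q)

  ^-one : ∀ n → 1ℚ ^ n ≡ 1ℚ
  ^-one zero    = refl
  ^-one (suc n) = trans (ℚₚ.*-identityˡ _) (^-one n)

  ^-superadditive : ∀ n → 0ℚ ℚ.≤ a → 0ℚ ℚ.≤ b →
                    a ^ suc n ℚ.+ b ^ suc n ℚ.≤ (a ℚ.+ b) ^ suc n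
  ^-superadditive {a} {b} zero 0≤a 0≤b = ℚₚ.≤-reflexive
    (sym (ℚₚ.*-distribʳ-+ 1ℚ a b))
  ^-superadditive {a} {b} (suc n) 0≤a 0≤b = begin
    a ℚ.* x ℚ.+ b ℚ.* y
      ≡⟨ sym (ℚₚ.+-identityʳ _) ⟩
    a ℚ.* x ℚ.+ b ℚ.* y ℚ.+ 0ℚ
      ≤⟨ ℚₚ.+-monoʳ-≤ (a ℚ.* x ℚ.+ b ℚ.* y)
           (+-nonNeg (*-nonNeg 0≤a (^-nonNeg (suc n) 0≤b))
                     (*-nonNeg 0≤b (^-nonNeg (suc n) 0≤a))) ⟩
    a ℚ.* x ℚ.+ b ℚ.* y ℚ.+ (a ℚ.* y ℚ.+ b ℚ.* x)
      ≡⟨ solve 4 (λ a b x y → a :* x :+ b :* y :+ (a :* y :+ b :* x)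
                           := (a :+ b) :* (x :+ y)) refl a b x y ⟩
    (a ℚ.+ b) ℚ.* (x ℚ.+ y)
      ≤⟨ *-monoˡ (+-nonNeg 0≤a 0≤b) (^-superadditive n 0≤a 0≤b) ⟩
    (a ℚ.+ b) ℚ.* (a ℚ.+ b) ^ suc n ∎
    where
    open ≤-Reasoning
    x y : ℚ
    x = a ^ suc n
    y = b ^ suc n

  <⇒≱ : p ℚ.< q → ¬ q ℚ.≤ p
  <⇒≱ p<q q≤p = ℚₚ.<-irrefl refl (<-≤-trans p<q q≤p)

  ∣-∣<-intro : p ℚ.< q ℚ.+ ε → q ℚ.< p ℚ.+ ε → ∣ p ℚ.- q ∣ ℚ.< ε
  ∣-∣<-intro {p} {q} {ε} p<q+ε q<p+ε with ℚₚ.∣p∣≡p∨∣p∣≡-p (p ℚ.- q)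
  ... | inj₁ eq = subst₂ ℚ._<_ (sym eq)
    (solve 2 (λ q e → q :+ e :- q := e) refl q ε) (ℚₚ.+-monoˡ-< (ℚ.- q) p<q+ε)
  ... | inj₂ eq = subst₂ ℚ._<_
    (trans (solve 2 (λ p q → q :- p := :- (p :- q)) refl p q) (sym eq))
    (solve 2 (λ p e → p :+ e :- p := e) refl p ε) (ℚₚ.+-monoˡ-< (ℚ.- p) q<p+ε)

  p≤∣p∣ : ∀ p → p ℚ.≤ ∣ p ∣
  p≤∣p∣ p with ℚₚ.≤-total 0ℚ p
  ... | inj₁ 0≤p = ℚₚ.≤-reflexive (sym (ℚₚ.0≤p⇒∣p∣≡p 0≤p))
  ... | inj₂ p≤0 = ≤-trans p≤0 (ℚₚ.0≤∣p∣ p)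

  ∣-∣-sym : ∀ p q → ∣ p ℚ.- q ∣ ≡ ∣ q ℚ.- p ∣
  ∣-∣-sym p q = trans (sym (ℚₚ.∣-p∣≡∣p∣ (p ℚ.- q)))
    (cong ∣_∣ (solve 2 (λ p q → :- (p :- q) := q :- p) refl p q))

  ∣-∣<-elim : ∣ p ℚ.- q ∣ ℚ.< ε → p ℚ.< q ℚ.+ ε
  ∣-∣<-elim {p} {q} {ε} h = subst (ℚ._< q ℚ.+ ε)
    (solve 2 (λ p q → q :+ (p :- q) := p) refl p q)
    (ℚₚ.+-monoʳ-< q (≤-<-trans (p≤∣p∣ (p ℚ.- q)) h))

  ⊔-shift : 0ℚ ℚ.< ε → p ℚ.< q ℚ.+ ε → p ℚ.⊔ 0ℚ ℚ.< q ℚ.⊔ 0ℚ ℚ.+ ε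
  ⊔-shift {ε} {p} {q} 0<ε p<q+ε with ℚₚ.⊔-sel p 0ℚ
  ... | inj₁ eq = subst (ℚ._< q ℚ.⊔ 0ℚ ℚ.+ ε) (sym eq)
    (<-≤-trans p<q+ε (ℚₚ.+-monoˡ-≤ ε (ℚₚ.p≤p⊔q q 0ℚ)))
  ... | inj₂ eq = subst (ℚ._< q ℚ.⊔ 0ℚ ℚ.+ ε) (sym eq)
    (subst (ℚ._< q ℚ.⊔ 0ℚ ℚ.+ ε) (ℚₚ.+-identityˡ 0ℚ)
      (ℚₚ.+-mono-≤-< (ℚₚ.p≤q⊔p q 0ℚ) 0<ε))

  recip-inverseʳ : ∀ p → 0ℚ ℚ.< p → p ℚ.* recip p ≡ 1ℚ
  recip-inverseʳ p 0<p with p ℚ.≟ 0ℚ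
  ... | yes p≡0 = contradiction (sym p≡0) (ℚₚ.<⇒≢ 0<p)
  ... | no p≢0  = ℚₚ.*-inverseʳ p {{ℚ.≢-nonZero p≢0}}

  recip-pos : ∀ p → 0ℚ ℚ.< p → 0ℚ ℚ.< recip p
  recip-pos p 0<p with p ℚ.≟ 0ℚ
  ... | yes p≡0 = contradiction (sym p≡0) (ℚₚ.<⇒≢ 0<p)
  ... | no p≢0  = ℚₚ.positive⁻¹ ((ℚ.1/ p) {{ℚ.≢-nonZero p≢0}})
    {{ℚₚ.1/pos⇒pos p {{ℚ.positive 0<p}}}}

  recip-anti : ∀ p q → 0ℚ ℚ.< p → p ℚ.≤ q → recip q ℚ.≤ recip p
  recip-anti p q 0<p p≤q = subst₂ ℚ._≤_
    (trans (cong (recip q ℚ.*_) (recip-inverseʳ p 0<p)) (ℚₚ.*-identityʳ _))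
    (trans (solve 3 (λ a b c → a :* (b :* c) := b :* a :* c) refl (recip q) q (recip p))
      (trans (cong (ℚ._* recip p) (recip-inverseʳ q 0<q)) (ℚₚ.*-identityˡ _)))
    (*-monoˡ (<⇒≤ (recip-pos q 0<q))
      (*-mono (<⇒≤ 0<p) p≤q (<⇒≤ (recip-pos p 0<p)) ℚₚ.≤-refl))
    where
    0<q : 0ℚ ℚ.< q
    0<q = <-≤-trans 0<p p≤q

  scale-bound : ∀ B → 0ℚ ℚ.< B → 0ℚ ℚ.< ε → ∃ λ δ → 0ℚ ℚ.< δ × B ℚ.* δ ≡ ε
  scale-bound {ε} B 0<B 0<ε = recip B ℚ.* ε , *-pos (recip-pos B 0<B) 0<ε ,
    trans (sym (ℚₚ.*-assoc B (recip B) ε))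
      (trans (cong (ℚ._* ε) (recip-inverseʳ B 0<B)) (ℚₚ.*-identityˡ ε))

  /-≃ : ∀ i n → ℚ.toℚᵘ (i / suc n) ℚᵘ.≃ mkℚᵘ i n
  /-≃ i n = ℚₚ.toℚᵘ-fromℚᵘ (mkℚᵘ i n)

  /-suc : ∀ j n → + suc j / suc n ≡ + j / suc n ℚ.+ + 1 / suc n
  /-suc j n = ℚₚ.toℚᵘ-injective (begin
    ℚ.toℚᵘ (+ suc j / suc n)                       ≈⟨ /-≃ (+ suc j) n ⟩
    mkℚᵘ (+ suc j) n                               ≈⟨ *≡* eq ⟩
    mkℚᵘ (+ j) n ℚᵘ.+ mkℚᵘ (+ 1) n
      ≈⟨ ℚᵘₚ.+-cong (ℚᵘₚ.≃-sym (/-≃ (+ j) n)) (ℚᵘₚ.≃-sym (/-≃ (+ 1) n)) ⟩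
    ℚ.toℚᵘ (+ j / suc n) ℚᵘ.+ ℚ.toℚᵘ (+ 1 / suc n)
      ≈⟨ ℚᵘₚ.≃-sym (ℚₚ.toℚᵘ-homo-+ (+ j / suc n) (+ 1 / suc n)) ⟩
    ℚ.toℚᵘ (+ j / suc n ℚ.+ + 1 / suc n)           ∎)
    where
    open ℚᵘₚ.≃-Reasoning
    N : ℤ
    N = + suc n
    eq : + suc j ℤ.* (N ℤ.* N) ≡ (+ j ℤ.* N ℤ.+ + 1 ℤ.* N) ℤ.* N
    eq = trans (cong (ℤ._* (N ℤ.* N)) (cong +_ (ℕₚ.+-comm 1 j)))
      (trans (sym (ℤₚ.*-assoc (+ j ℤ.+ + 1) N N))
        (cong (ℤ._* N) (ℤₚ.*-distribʳ-+ N (+ j) (+ 1))))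

  /-mono : ∀ i m j n → i ℕ.* suc n ℕ.≤ j ℕ.* suc m → + i / suc m ℚ.≤ + j / suc n
  /-mono i m j n h = ℚₚ.toℚᵘ-cancel-≤
    (ℚᵘₚ.≤-respˡ-≃ (ℚᵘₚ.≃-sym (/-≃ (+ i) m))
      (ℚᵘₚ.≤-respʳ-≃ (ℚᵘₚ.≃-sym (/-≃ (+ j) n))
        (ℚᵘ.*≤* (subst₂ ℤ._≤_ (ℤₚ.pos-* i (suc n)) (ℤₚ.pos-* j (suc m)) (ℤ.+≤+ h)))))

  /-mono-< : ∀ i m j n → i ℕ.* suc n ℕ.< j ℕ.* suc m → + i / suc m ℚ.< + j / suc n
  /-mono-< i m j n h = ℚₚ.toℚᵘ-cancel-<
    (ℚᵘₚ.<-respˡ-≃ (ℚᵘₚ.≃-sym (/-≃ (+ i) m))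
      (ℚᵘₚ.<-respʳ-≃ (ℚᵘₚ.≃-sym (/-≃ (+ j) n))
        (ℚᵘ.*<* (subst₂ ℤ._<_ (ℤₚ.pos-* i (suc n)) (ℤₚ.pos-* j (suc m)) (ℤ.+<+ h)))))

  /-nonNeg : ∀ j n → 0ℚ ℚ.≤ + j / suc n
  /-nonNeg j n = /-mono 0 0 j n z≤n

  /-pos : ∀ j n → 0ℚ ℚ.< + suc j / suc n
  /-pos j n = /-mono-< 0 0 (suc j) n (s≤s z≤n)

  archimedean : ∀ ε → 0ℚ ℚ.< ε → ∃ λ N → ∀ n → N ℕ.≤ n → + 1 / suc n ℚ.< ε
  archimedean (ℚ.mkℚ (+ zero) d c)  0<ε = contradiction (ℚₚ.drop-*<* 0<ε) λ { (ℤ.+<+ ()) }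
  archimedean ε@(ℚ.mkℚ (+ suc i) d c) 0<ε = suc d , λ n d<n →
    subst (+ 1 / suc n ℚ.<_) (ℚₚ.↥p/↧p≡p ε)
      (/-mono-< 1 n (suc i) d
        (ℕₚ.≤-trans (s≤s (subst (ℕ._≤ n) (sym (ℕₚ.*-identityˡ (suc d))) d<n))
          (ℕₚ.m≤m+n (suc n) (i ℕ.* suc n))))
  archimedean (ℚ.mkℚ ℤ.-[1+ i ] d c) 0<ε = contradiction (ℚₚ.drop-*<* 0<ε) λ ()

  <-integer : ∀ q → q ℚ.< + suc ℤ.∣ ℚ.↥ q ∣ / 1
  <-integer q@(ℚ.mkℚ (+ i) d _) = subst (ℚ._< + suc i / 1) (ℚₚ.↥p/↧p≡p q)
    (/-mono-< i d (suc i) 0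
      (ℕₚ.<-≤-trans (subst (ℕ._< suc i) (sym (ℕₚ.*-identityʳ i)) (ℕₚ.n<1+n i))
        (ℕₚ.m≤m*n (suc i) (suc d))))
  <-integer q@(ℚ.mkℚ ℤ.-[1+ i ] d _) =
    <-trans (ℚₚ.negative⁻¹ q) (/-pos (suc i) 0)

Cauchy : (ℕ → ℚ) → Set
Cauchy x = ∀ ε → 0ℚ ℚ.< ε → ∃ λ N → ∀ m n → N ℕ.≤ m → N ℕ.≤ n →
           ∣ x m ℚ.- x n ∣ ℚ.< ε

record ℝ : Set where
  no-eta-equality
  field
    seq    : ℕ → ℚ
    cauchy : Cauchy seq

open ℝ public

infix 4 _≈ℝ_ _<ℝ_

record _≈ℝ_ (x y : ℝ) : Set where
  constructor mk≈ℝ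
  field
    close : ∀ ε → 0ℚ ℚ.< ε → ∃ λ N → ∀ n → N ℕ.≤ n →
            ∣ seq x n ℚ.- seq y n ∣ ℚ.< ε

record _<ℝ_ (x y : ℝ) : Set where
  constructor mk<ℝ
  field
    gap       : ℚ
    gap-pos   : 0ℚ ℚ.< gap
    index     : ℕ
    separated : ∀ n → index ℕ.≤ n → seq x n ℚ.+ gap ℚ.≤ seq y n

abstract

  mkCauchy : (x : Seq) →
             (∀ ε → 0ℚ ℚ.< ε → ∃ λ N → ∀ m n → N ℕ.≤ m → N ℕ.≤ n →
               x m ℚ.< x n ℚ.+ ε) →
             Cauchy x
  mkCauchy x h ε 0<ε with h ε 0<ε
  ... | N , close = N , λ m n N≤m N≤n →
    ∣-∣<-intro (close m n N≤m N≤n) (close n m N≤n N≤m)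

  -- A uniform tail bound C / (n + 1) for m ≥ n makes a sequence Cauchy.
  tail⇒Cauchy : (x : Seq) (C : ℚ) → 0ℚ ℚ.< C →
                (∀ n d → ∣ x (d ℕ.+ n) ℚ.- x n ∣ ℚ.≤ C ℚ.* (+ 1 / suc n)) →
                Cauchy x
  tail⇒Cauchy x C 0<C tail ε 0<ε with scale-bound C 0<C 0<ε
  ... | δ , 0<δ , Cδ with archimedean δ 0<δ
  ... | N , small = N , close
    where
    above : ∀ m n → N ℕ.≤ n → n ℕ.≤ m → ∣ x m ℚ.- x n ∣ ℚ.< ε
    above m n N≤n n≤m = ≤-<-trans
      (subst (λ i → ∣ x i ℚ.- x n ∣ ℚ.≤ C ℚ.* (+ 1 / suc n)) (ℕₚ.m∸n+n≡m n≤m)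
        (tail n (m ℕ.∸ n)))
      (subst (C ℚ.* (+ 1 / suc n) ℚ.<_) Cδ (*-monoˡ-< 0<C (small n N≤n)))
    close : ∀ m n → N ℕ.≤ m → N ℕ.≤ n → ∣ x m ℚ.- x n ∣ ℚ.< ε
    close m n N≤m N≤n with ℕₚ.≤-total n m
    ... | inj₁ n≤m = above m n N≤n n≤m
    ... | inj₂ m≤n = subst (ℚ._< ε) (∣-∣-sym (x n) (x m)) (above n m N≤m m≤n)

  const-cauchy : ∀ q → Cauchy (λ _ → q)
  const-cauchy q ε 0<ε = 0 , λ _ _ _ _ →
    subst (ℚ._< ε) (sym (cong ∣_∣ (ℚₚ.+-inverseʳ q))) 0<ε

  +-cauchy : ∀ (x y : Seq) → Cauchy x → Cauchy y → Cauchy (λ n → x n ℚ.+ y n)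
  +-cauchy x y cx cy ε 0<ε
    with cx (½ ℚ.* ε) (0<½* 0<ε) | cy (½ ℚ.* ε) (0<½* 0<ε)
  ... | M , hx | N , hy = M ℕ.⊔ N , λ m n m≥ n≥ →
    ≤-<-trans
      (subst (λ t → ∣ t ∣ ℚ.≤ ∣ x m ℚ.- x n ∣ ℚ.+ ∣ y m ℚ.- y n ∣)
        (solve 4 (λ a b c d → a :- b :+ (c :- d) := a :+ c :- (b :+ d)) refl
          (x m) (x n) (y m) (y n))
        (ℚₚ.∣p+q∣≤∣p∣+∣q∣ (x m ℚ.- x n) (y m ℚ.- y n)))
      (subst (_ ℚ.<_) (halves ε)
        (ℚₚ.+-mono-< (hx m n (ℕₚ.m⊔n≤o⇒m≤o M N m≥) (ℕₚ.m⊔n≤o⇒m≤o M N n≥))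
                     (hy m n (ℕₚ.m⊔n≤o⇒n≤o M N m≥) (ℕₚ.m⊔n≤o⇒n≤o M N n≥))))

  neg-cauchy : ∀ (x : Seq) → Cauchy x → Cauchy (λ n → ℚ.- x n)
  neg-cauchy x cx ε 0<ε with cx ε 0<ε
  ... | N , h = N , λ m n N≤m N≤n → subst (ℚ._< ε)
    (trans (sym (ℚₚ.∣-p∣≡∣p∣ (x m ℚ.- x n)))
      (cong ∣_∣ (solve 2 (λ a b → :- (a :- b) := :- a :- (:- b)) refl (x m) (x n))))
    (h m n N≤m N≤n)

  eventually-bounded : ∀ (x : Seq) → Cauchy x →
    ∃ λ B → 0ℚ ℚ.< B × ∃ λ N → ∀ n → N ℕ.≤ n → ∣ x n ∣ ℚ.≤ B
  eventually-bounded x cx with cx 1ℚ 0<1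
  ... | N , h =
    1ℚ ℚ.+ ∣ x N ∣ ,
    subst (ℚ._< 1ℚ ℚ.+ ∣ x N ∣) (ℚₚ.+-identityʳ 0ℚ) (ℚₚ.+-mono-<-≤ 0<1 (ℚₚ.0≤∣p∣ (x N))) ,
    N , λ n N≤n → ≤-trans
      (subst (λ t → ∣ t ∣ ℚ.≤ ∣ x n ℚ.- x N ∣ ℚ.+ ∣ x N ∣)
        (solve 2 (λ a b → a :- b :+ b := a) refl (x n) (x N))
        (ℚₚ.∣p+q∣≤∣p∣+∣q∣ (x n ℚ.- x N) (x N)))
      (ℚₚ.+-monoˡ-≤ ∣ x N ∣ (<⇒≤ (h n N N≤n ℕₚ.≤-refl)))

  product-near : ∀ a b c d → ∣ a ℚ.* c ℚ.- b ℚ.* d ∣ ℚ.≤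
                 ∣ a ∣ ℚ.* ∣ c ℚ.- d ∣ ℚ.+ ∣ d ∣ ℚ.* ∣ a ℚ.- b ∣
  product-near a b c d = subst₂ ℚ._≤_ (cong ∣_∣ (sym eq))
    (cong₂ ℚ._+_ (ℚₚ.∣p*q∣≡∣p∣*∣q∣ a (c ℚ.- d)) (ℚₚ.∣p*q∣≡∣p∣*∣q∣ d (a ℚ.- b)))
    (ℚₚ.∣p+q∣≤∣p∣+∣q∣ (a ℚ.* (c ℚ.- d)) (d ℚ.* (a ℚ.- b)))
    where
    eq : a ℚ.* c ℚ.- b ℚ.* d ≡ a ℚ.* (c ℚ.- d) ℚ.+ d ℚ.* (a ℚ.- b)
    eq = solve 4 (λ a b c d → a :* c :- b :* d := a :* (c :- d) :+ d :* (a :- b))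
      refl a b c d

  weighted-< : {A B x y u v : ℚ} → 0ℚ ℚ.< A → 0ℚ ℚ.< B →
    x ℚ.≤ A → 0ℚ ℚ.≤ x → u ℚ.< p → 0ℚ ℚ.≤ u →
    y ℚ.≤ B → 0ℚ ℚ.≤ y → v ℚ.< q → 0ℚ ℚ.≤ v →
    x ℚ.* u ℚ.+ y ℚ.* v ℚ.< A ℚ.* p ℚ.+ B ℚ.* q
  weighted-< 0<A 0<B x≤A 0≤x u<p 0≤u y≤B 0≤y v<q 0≤v = ≤-<-trans
    (ℚₚ.+-mono-≤ (*-mono 0≤x x≤A 0≤u ℚₚ.≤-refl) (*-mono 0≤y y≤B 0≤v ℚₚ.≤-refl))
    (ℚₚ.+-mono-< (*-monoˡ-< 0<A u<p) (*-monoˡ-< 0<B v<q))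

  *-cauchy : ∀ (x y : Seq) → Cauchy x → Cauchy y → Cauchy (λ n → x n ℚ.* y n)
  *-cauchy x y cx cy ε 0<ε =
    let A , 0<A , N₁ , hA = eventually-bounded x cx
        B , 0<B , N₂ , hB = eventually-bounded y cy
        α , 0<α , Aα = scale-bound A 0<A (0<½* 0<ε)
        β , 0<β , Bβ = scale-bound B 0<B (0<½* 0<ε)
        N₃ , hy = cy α 0<α
        N₄ , hx = cx β 0<β
        ≥₁₂ : ∀ {k} → (N₁ ℕ.⊔ N₂) ℕ.⊔ (N₃ ℕ.⊔ N₄) ℕ.≤ k → N₁ ℕ.⊔ N₂ ℕ.≤ k
        ≥₁₂ = ℕₚ.m⊔n≤o⇒m≤o (N₁ ℕ.⊔ N₂) (N₃ ℕ.⊔ N₄)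
        ≥₃₄ : ∀ {k} → (N₁ ℕ.⊔ N₂) ℕ.⊔ (N₃ ℕ.⊔ N₄) ℕ.≤ k → N₃ ℕ.⊔ N₄ ℕ.≤ k
        ≥₃₄ = ℕₚ.m⊔n≤o⇒n≤o (N₁ ℕ.⊔ N₂) (N₃ ℕ.⊔ N₄)
    in (N₁ ℕ.⊔ N₂) ℕ.⊔ (N₃ ℕ.⊔ N₄) , λ m n m≥ n≥ →
      ≤-<-trans (product-near (x m) (x n) (y m) (y n))
        (<-≤-trans
          (weighted-< 0<A 0<B
            (hA m (ℕₚ.m⊔n≤o⇒m≤o N₁ N₂ (≥₁₂ m≥))) (ℚₚ.0≤∣p∣ (x m))
            (hy m n (ℕₚ.m⊔n≤o⇒m≤o N₃ N₄ (≥₃₄ m≥)) (ℕₚ.m⊔n≤o⇒m≤o N₃ N₄ (≥₃₄ n≥)))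
            (ℚₚ.0≤∣p∣ (y m ℚ.- y n))
            (hB n (ℕₚ.m⊔n≤o⇒n≤o N₁ N₂ (≥₁₂ n≥))) (ℚₚ.0≤∣p∣ (y n))
            (hx m n (ℕₚ.m⊔n≤o⇒n≤o N₃ N₄ (≥₃₄ m≥)) (ℕₚ.m⊔n≤o⇒n≤o N₃ N₄ (≥₃₄ n≥)))
            (ℚₚ.0≤∣p∣ (x m ℚ.- x n)))
          (ℚₚ.≤-reflexive (trans (cong₂ ℚ._+_ Aα Bβ) (halves ε))))

fromℚ : ℚ → ℝ
fromℚ q .seq _  = q
fromℚ q .cauchy = const-cauchy q

fromℕ : ℕ → ℝ
fromℕ n = fromℚ (+ n / 1)

0ℝ 1ℝ : ℝ
0ℝ = fromℚ 0ℚ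
1ℝ = fromℚ 1ℚ

abstract

  recip-cauchy : (x : ℝ) → 0ℝ <ℝ x →
                 Cauchy (λ n → recip (seq x n))
  recip-cauchy x (mk<ℝ δ 0<δ M big) ε 0<ε
    with scale-bound (recip δ ℚ.* recip δ) (*-pos (recip-pos δ 0<δ) (recip-pos δ 0<δ)) 0<ε
  ... | η , 0<η , eq with cauchy x η 0<η
  ... | K , near = M ℕ.⊔ K , λ m n m≥ n≥ →
    subst₂ ℚ._<_ (identity m n (ℕₚ.m⊔n≤o⇒m≤o M K m≥) (ℕₚ.m⊔n≤o⇒m≤o M K n≥)) eq
      (≤-<-trans
        (*-mono (*-nonNeg (r≥0 m (ℕₚ.m⊔n≤o⇒m≤o M K m≥)) (r≥0 n (ℕₚ.m⊔n≤o⇒m≤o M K n≥)))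
                (*-mono (r≥0 m (ℕₚ.m⊔n≤o⇒m≤o M K m≥)) (r≤ m (ℕₚ.m⊔n≤o⇒m≤o M K m≥))
                        (r≥0 n (ℕₚ.m⊔n≤o⇒m≤o M K n≥)) (r≤ n (ℕₚ.m⊔n≤o⇒m≤o M K n≥)))
                (ℚₚ.0≤∣p∣ (seq x n ℚ.- seq x m)) ℚₚ.≤-refl)
        (*-monoˡ-< (*-pos (recip-pos δ 0<δ) (recip-pos δ 0<δ))
          (near n m (ℕₚ.m⊔n≤o⇒n≤o M K n≥) (ℕₚ.m⊔n≤o⇒n≤o M K m≥))))
    where
    δ≤ : ∀ n → M ℕ.≤ n → δ ℚ.≤ seq x n
    δ≤ n M≤n = subst (ℚ._≤ seq x n) (ℚₚ.+-identityˡ δ) (big n M≤n)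
    r≥0 : ∀ n → M ℕ.≤ n → 0ℚ ℚ.≤ recip (seq x n)
    r≥0 n M≤n = <⇒≤ (recip-pos (seq x n) (<-≤-trans 0<δ (δ≤ n M≤n)))
    r≤ : ∀ n → M ℕ.≤ n → recip (seq x n) ℚ.≤ recip δ
    r≤ n M≤n = recip-anti δ (seq x n) 0<δ (δ≤ n M≤n)
    identity : ∀ m n → M ℕ.≤ m → M ℕ.≤ n →
      recip (seq x m) ℚ.* recip (seq x n) ℚ.* ∣ seq x n ℚ.- seq x m ∣
        ≡ ∣ recip (seq x m) ℚ.- recip (seq x n) ∣
    identity m n M≤m M≤n = trans
      (cong (ℚ._* ∣ v ℚ.- u ∣) (sym (ℚₚ.0≤p⇒∣p∣≡p (*-nonNeg (r≥0 m M≤m) (r≥0 n M≤n)))))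
      (trans (sym (ℚₚ.∣p*q∣≡∣p∣*∣q∣ (r ℚ.* s) (v ℚ.- u)))
        (cong ∣_∣
          (trans (solve 4 (λ a b r s → r :* s :* (b :- a) := r :* (b :* s) :- s :* (a :* r))
                   refl u v r s)
            (cong₂ ℚ._-_
              (trans (cong (r ℚ.*_) (recip-inverseʳ v (<-≤-trans 0<δ (δ≤ n M≤n)))) (ℚₚ.*-identityʳ r))
              (trans (cong (s ℚ.*_) (recip-inverseʳ u (<-≤-trans 0<δ (δ≤ m M≤m)))) (ℚₚ.*-identityʳ s))))))
      where
      u v r s : ℚ
      u = seq x m
      v = seq x n
      r = recip u
      s = recip v

infixl 6 _+ℝ_
infixl 7 _*ℝ_
infix  8 -ℝ_

_+ℝ_ _*ℝ_ : ℝ → ℝ → ℝ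
(x +ℝ y) .seq n  = seq x n ℚ.+ seq y n
(x +ℝ y) .cauchy = +-cauchy (seq x) (seq y) (cauchy x) (cauchy y)
(x *ℝ y) .seq n  = seq x n ℚ.* seq y n
(x *ℝ y) .cauchy = *-cauchy (seq x) (seq y) (cauchy x) (cauchy y)

-ℝ_ : ℝ → ℝ
(-ℝ x) .seq n  = ℚ.- seq x n
(-ℝ x) .cauchy = neg-cauchy (seq x) (cauchy x)

invℝ : (x : ℝ) → 0ℝ <ℝ x → ℝ
invℝ x 0<x .seq n  = recip (seq x n)
invℝ x 0<x .cauchy = recip-cauchy x 0<x

ℝ-rawRing : RawRing 0ℓ 0ℓ
ℝ-rawRing = record
  { Carrier = ℝ ; _≈_ = _≈ℝ_ ; _+_ = _+ℝ_ ; _*_ = _*ℝ_ ; -_ = -ℝ_ ; 0# = 0ℝ ; 1# = 1ℝ }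

open RawSemiringDefs (RawRing.rawSemiring ℝ-rawRing) public
  using () renaming (_^_ to infixr 8 _^ℝ_)

-- The greatest j ≤ b satisfying P, among j ≥ 1 (and 0 if there is none).
greatest : {P : ℕ → Set} → (∀ j → Dec (P j)) → ℕ → ℕ
greatest P? zero = 0
greatest P? (suc b) with P? (suc b)
... | yes _ = suc b
... | no  _ = greatest P? b

-- The m-th root of max q 0, rounded down to a multiple of 1 / (n + 1).
-- The search bound exceeds (n + 1) * max q 0 and is at least n + 1.
rootApprox : (m n : ℕ) → ℚ → ℚ
rootApprox m n q =
  + greatest (λ j → (+ j / suc n) ^ m ℚ.≤? q ℚ.⊔ 0ℚ)
             (suc ℤ.∣ ℚ.↥ (q ℚ.⊔ 0ℚ) ∣ ℕ.* suc n)
  / suc n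

abstract

  greatest-holds : {P : ℕ → Set} (P? : ∀ j → Dec (P j)) (b : ℕ) →
                   P 0 → P (greatest P? b)
  greatest-holds P? zero    P0 = P0
  greatest-holds P? (suc b) P0 with P? (suc b)
  ... | yes Pb = Pb
  ... | no  _  = greatest-holds P? b P0

  greatest-fails : {P : ℕ → Set} (P? : ∀ j → Dec (P j)) (b : ℕ) →
                   ¬ P (suc b) → ¬ P (suc (greatest P? b))
  greatest-fails P? zero    ¬P = ¬P
  greatest-fails P? (suc b) ¬P with P? (suc b)
  ... | yes _  = ¬P
  ... | no ¬Pb = greatest-fails P? b ¬Pb

  p≤p^ : ∀ m → 1ℚ ℚ.≤ p → p ℚ.≤ p ^ suc m
  p≤p^ {p} m 1≤p = subst (ℚ._≤ p ^ suc m) (ℚₚ.*-identityʳ p)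
    (*-monoˡ (≤-trans 0≤1 1≤p)
      (subst (ℚ._≤ p ^ m) (^-one m) (^-mono m 0≤1 1≤p)))

  rootApprox-nonNeg : ∀ m n q → 0ℚ ℚ.≤ rootApprox m n q
  rootApprox-nonNeg m n q = /-nonNeg
    (greatest (λ j → (+ j / suc n) ^ m ℚ.≤? q ℚ.⊔ 0ℚ) (suc ℤ.∣ ℚ.↥ (q ℚ.⊔ 0ℚ) ∣ ℕ.* suc n)) n

  rootApprox-lower : ∀ m n q → rootApprox (suc m) n q ^ suc m ℚ.≤ q ℚ.⊔ 0ℚ
  rootApprox-lower m n q = greatest-holds {λ j → (+ j / suc n) ^ suc m ℚ.≤ r}
    (λ j → (+ j / suc n) ^ suc m ℚ.≤? r) (suc ℤ.∣ ℚ.↥ r ∣ ℕ.* suc n)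
    (subst (ℚ._≤ r)
      (sym (trans (cong (λ t → t ℚ.* t ^ m) (ℚₚ.0/n≡0 (suc n))) (ℚₚ.*-zeroˡ (0ℚ ^ m))))
      (ℚₚ.p≤q⊔p q 0ℚ))
    where
    r : ℚ
    r = q ℚ.⊔ 0ℚ

  rootApprox-upper : ∀ m n q →
    q ℚ.⊔ 0ℚ ℚ.< (rootApprox (suc m) n q ℚ.+ + 1 / suc n) ^ suc m
  rootApprox-upper m n q = subst (λ t → r ℚ.< t ^ suc m) (/-suc (greatest P? B) n)
    (ℚₚ.≰⇒> (greatest-fails {λ j → (+ j / suc n) ^ suc m ℚ.≤ r} P? B
      (<⇒≱ (<-≤-trans (<-≤-trans (<-integer r) large)
        (p≤p^ {+ suc B / suc n} m (≤-trans (/-mono 1 0 (suc i) 0 (s≤s z≤n)) large))))))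
    where
    r : ℚ
    r = q ℚ.⊔ 0ℚ
    P? : ∀ j → Dec ((+ j / suc n) ^ suc m ℚ.≤ r)
    P? j = (+ j / suc n) ^ suc m ℚ.≤? r
    i B : ℕ
    i = ℤ.∣ ℚ.↥ r ∣
    B = suc i ℕ.* suc n
    large : + suc i / 1 ℚ.≤ + suc B / suc n
    large = /-mono (suc i) 0 (suc B) n
      (subst (B ℕ.≤_) (sym (ℕₚ.*-identityʳ (suc B))) (ℕₚ.n≤1+n B))

  root-near : ∀ m {u v t h : ℚ} → 0ℚ ℚ.< h → 0ℚ ℚ.≤ v ℚ.+ t → t ℚ.≤ h →
    u ^ suc m ℚ.≤ a → b ℚ.< (v ℚ.+ t) ^ suc m → a ℚ.< b ℚ.+ h ^ suc m →
    u ℚ.< v ℚ.+ (h ℚ.+ h)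
  root-near {a} {b} m {u} {v} {t} {h} 0<h 0≤v+t t≤h u^≤a b<v^ a<b+h^ = ℚₚ.≰⇒> λ far →
    <⇒≱ (<-trans a<b+h^ (ℚₚ.+-monoˡ-< (h ^ suc m) b<v^))
      (≤-trans (^-superadditive m 0≤v+t (<⇒≤ 0<h))
        (≤-trans
          (^-mono (suc m) (+-nonNeg 0≤v+t (<⇒≤ 0<h))
            (≤-trans (ℚₚ.+-monoˡ-≤ h (ℚₚ.+-monoʳ-≤ v t≤h))
              (≤-trans (ℚₚ.≤-reflexive (ℚₚ.+-assoc v h h)) far)))
          u^≤a))

  roots⇒Cauchy : ∀ m (x u t : Seq) → Cauchy x →
    (∀ ε → 0ℚ ℚ.< ε → ∃ λ N → ∀ n → N ℕ.≤ n → t n ℚ.< ε) →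
    (∀ n → 0ℚ ℚ.≤ u n ℚ.+ t n) →
    (∀ n → u n ^ suc m ℚ.≤ x n ℚ.⊔ 0ℚ) →
    (∀ n → x n ℚ.⊔ 0ℚ ℚ.< (u n ℚ.+ t n) ^ suc m) →
    Cauchy u
  roots⇒Cauchy m x u t cx t→0 0≤u+t lower upper = mkCauchy u λ ε 0<ε →
    let h : ℚ
        h = ½ ℚ.* ε
        0<h : 0ℚ ℚ.< h
        0<h = 0<½* {ε} 0<ε
        0<δ : 0ℚ ℚ.< h ^ suc m
        0<δ = ^-pos {h} (suc m) 0<h
        K , small = t→0 h 0<h
        M , near = cx (h ^ suc m) 0<δ
    in K ℕ.⊔ M , λ i j i≥ j≥ →
      subst (λ r → u i ℚ.< u j ℚ.+ r) (halves ε)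
        (root-near {x i ℚ.⊔ 0ℚ} {x j ℚ.⊔ 0ℚ} m {u i} {u j} {t j} {h} 0<h (0≤u+t j)
          (<⇒≤ (small j (ℕₚ.m⊔n≤o⇒m≤o K M j≥))) (lower i) (upper j)
          (⊔-shift {h ^ suc m} {x i} {x j} 0<δ
            (∣-∣<-elim {x i} {x j} {h ^ suc m}
              (near i j (ℕₚ.m⊔n≤o⇒n≤o K M i≥) (ℕₚ.m⊔n≤o⇒n≤o K M j≥)))))

  root-cauchy : ∀ m (x : Seq) → Cauchy x → Cauchy (λ n → rootApprox (suc m) n (x n))
  root-cauchy m x cx =
    roots⇒Cauchy m x (λ n → rootApprox (suc m) n (x n)) (λ n → + 1 / suc n) cx archimedean
      (λ n → +-nonNeg {rootApprox (suc m) n (x n)} {+ 1 / suc n}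
        (rootApprox-nonNeg (suc m) n (x n)) (/-nonNeg 1 n))
      (λ n → rootApprox-lower m n (x n))
      (λ n → rootApprox-upper m n (x n))

-- The m-th root of x for x ≥ 0.
root : (m : ℕ) → .{{ℕ.NonZero m}} → ℝ → ℝ
root m x .seq n        = rootApprox m n (seq x n)
root (suc m) x .cauchy = root-cauchy m (seq x) (cauchy x)

-- x to the power p / q for x ≥ 0.
infixr 8 _^[_/_]
_^[_/_] : ℝ → (p q : ℕ) → .{{ℕ.NonZero q}} → ℝ
x ^[ p / q ] = root q (x ^ℝ p)

-- ∑ 1 / i! over i < n.
eSeq : ℕ → ℚ
eSeq zero    = 0ℚ
eSeq (suc n) = eSeq n ℚ.+ (+ 1 / (n !)) {{n ℕₚ.!≢0}}

-- 4 ∑ (-1) ^ i / (2 i + 1) over i < n (Leibniz).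
πSeq : ℕ → ℚ
πSeq zero    = 0ℚ
πSeq (suc n) = πSeq n ℚ.+ (ℚ.- 1ℚ) ^ n ℚ.* (+ 4 / suc (2 ℕ.* n))

abstract

  /1-* : ∀ i n → + i / 1 ℚ.* (+ 1 / suc n) ≡ + i / suc n
  /1-* i n = ℚₚ.toℚᵘ-injective (begin
    ℚ.toℚᵘ (+ i / 1 ℚ.* (+ 1 / suc n))
      ≈⟨ ℚₚ.toℚᵘ-homo-* (+ i / 1) (+ 1 / suc n) ⟩
    ℚ.toℚᵘ (+ i / 1) ℚᵘ.* ℚ.toℚᵘ (+ 1 / suc n)
      ≈⟨ ℚᵘₚ.*-cong (/-≃ (+ i) 0) (/-≃ (+ 1) n) ⟩
    mkℚᵘ (+ i) 0 ℚᵘ.* mkℚᵘ (+ 1) n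
      ≈⟨ *≡* (cong₂ ℤ._*_ (ℤₚ.*-identityʳ (+ i))
                          (cong (+_ ∘ suc) (sym (ℕₚ.+-identityʳ n)))) ⟩
    mkℚᵘ (+ i) n
      ≈⟨ ℚᵘₚ.≃-sym (/-≃ (+ i) n) ⟩
    ℚ.toℚᵘ (+ i / suc n) ∎)
    where open ℚᵘₚ.≃-Reasoning

  factorial-bound : ∀ n → suc n ℕ.* suc (suc n) ℕ.≤ 6 ℕ.* (n !)
  factorial-bound 0 = s≤s (s≤s z≤n)
  factorial-bound 1 = ℕₚ.≤-refl
  factorial-bound (suc n@(suc i)) = begin
    (1 ℕ.+ suc n) ℕ.* suc (suc (suc n))
      ≤⟨ ℕₚ.*-monoʳ-≤ (suc (suc n)) (s≤s (ℕₚ.≤-trans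
           (ℕₚ.≤-reflexive (ℕₚ.+-comm 2 n))
           (ℕₚ.+-monoʳ-≤ n (ℕₚ.≤-trans (s≤s (s≤s z≤n)) (ℕₚ.m≤m+n (suc n) (i ℕ.* suc n)))))) ⟩
    suc (suc n) ℕ.* (suc n ℕ.* suc n)
      ≡⟨ trans (ℕₚ.*-comm (suc (suc n)) (suc n ℕ.* suc n))
           (ℕₚ.*-assoc (suc n) (suc n) (suc (suc n))) ⟩
    suc n ℕ.* (suc n ℕ.* suc (suc n))
      ≤⟨ ℕₚ.*-monoʳ-≤ (suc n) (factorial-bound n) ⟩
    suc n ℕ.* (6 ℕ.* (n !))
      ≡⟨ trans (sym (ℕₚ.*-assoc (suc n) 6 (n !)))
           (trans (cong (ℕ._* (n !)) (ℕₚ.*-comm (suc n) 6)) (ℕₚ.*-assoc 6 (suc n) (n !))) ⟩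
    6 ℕ.* (suc n !) ∎
    where open ℕₚ.≤-Reasoning

  telescope : ∀ n → + 6 / suc n ≡ + 6 / (suc n ℕ.* suc (suc n)) ℚ.+ + 6 / suc (suc n)
  telescope n = ℚₚ.toℚᵘ-injective (begin
    ℚ.toℚᵘ (+ 6 / suc n)
      ≈⟨ /-≃ (+ 6) n ⟩
    mkℚᵘ (+ 6) n
      ≈⟨ *≡* (ℤ-solve 1 (λ x → ℤcon (+ 6) ℤ:* ((x ℤ:* (ℤcon (+ 1) ℤ:+ x)) ℤ:* (ℤcon (+ 1) ℤ:+ x))
           ℤ:= (ℤcon (+ 6) ℤ:* (ℤcon (+ 1) ℤ:+ x) ℤ:+ ℤcon (+ 6) ℤ:* (x ℤ:* (ℤcon (+ 1) ℤ:+ x))) ℤ:* x)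
           refl (+ suc n)) ⟩
    mkℚᵘ (+ 6) (suc n ℕ.+ n ℕ.* suc (suc n)) ℚᵘ.+ mkℚᵘ (+ 6) (suc n)
      ≈⟨ ℚᵘₚ.+-cong (ℚᵘₚ.≃-sym (/-≃ (+ 6) (suc n ℕ.+ n ℕ.* suc (suc n))))
                    (ℚᵘₚ.≃-sym (/-≃ (+ 6) (suc n))) ⟩
    ℚ.toℚᵘ (+ 6 / (suc n ℕ.* suc (suc n))) ℚᵘ.+ ℚ.toℚᵘ (+ 6 / suc (suc n))
      ≈⟨ ℚᵘₚ.≃-sym (ℚₚ.toℚᵘ-homo-+ (+ 6 / (suc n ℕ.* suc (suc n))) (+ 6 / suc (suc n))) ⟩
    ℚ.toℚᵘ (+ 6 / (suc n ℕ.* suc (suc n)) ℚ.+ + 6 / suc (suc n)) ∎)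
    where open ℚᵘₚ.≃-Reasoning

  /-mono-nonZero : ∀ i m j n .{{_ : ℕ.NonZero m}} .{{_ : ℕ.NonZero n}} →
                   i ℕ.* n ℕ.≤ j ℕ.* m → + i / m ℚ.≤ + j / n
  /-mono-nonZero i (suc m) j (suc n) = /-mono i m j n

  inverse-factorial-nonNeg : ∀ n → 0ℚ ℚ.≤ (+ 1 / (n !)) {{n ℕₚ.!≢0}}
  inverse-factorial-nonNeg n = /-mono-nonZero 0 1 1 (n !) {{_}} {{n ℕₚ.!≢0}} z≤n

  inverse-factorial-bound : ∀ n →
    (+ 1 / (n !)) {{n ℕₚ.!≢0}} ℚ.+ + 6 / suc (suc n) ℚ.≤ + 6 / suc n
  inverse-factorial-bound n = subst
    ((+ 1 / (n !)) {{n ℕₚ.!≢0}} ℚ.+ + 6 / suc (suc n) ℚ.≤_) (sym (telescope n))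
    (ℚₚ.+-monoˡ-≤ (+ 6 / suc (suc n))
      (/-mono-nonZero 1 (n !) 6 (suc n ℕ.* suc (suc n)) {{n ℕₚ.!≢0}}
        (subst (ℕ._≤ 6 ℕ.* (n !)) (sym (ℕₚ.*-identityˡ (suc n ℕ.* suc (suc n))))
          (factorial-bound n))))

  eSeq-mono : ∀ d n → eSeq n ℚ.≤ eSeq (d ℕ.+ n)
  eSeq-mono zero    n = ℚₚ.≤-refl
  eSeq-mono (suc d) n = ≤-trans (eSeq-mono d n)
    (subst (ℚ._≤ eSeq (suc d ℕ.+ n)) (ℚₚ.+-identityʳ (eSeq (d ℕ.+ n)))
      (ℚₚ.+-monoʳ-≤ (eSeq (d ℕ.+ n)) (inverse-factorial-nonNeg (d ℕ.+ n))))

  eSeq-tail : ∀ d n → eSeq (d ℕ.+ n) ℚ.+ + 6 / suc (d ℕ.+ n) ℚ.≤ eSeq n ℚ.+ + 6 / suc n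
  eSeq-tail zero    n = ℚₚ.≤-refl
  eSeq-tail (suc d) n = ≤-trans
    (≤-trans (ℚₚ.≤-reflexive (ℚₚ.+-assoc (eSeq (d ℕ.+ n)) _ (+ 6 / suc (suc (d ℕ.+ n)))))
      (ℚₚ.+-monoʳ-≤ (eSeq (d ℕ.+ n)) (inverse-factorial-bound (d ℕ.+ n))))
    (eSeq-tail d n)

  gap-bound : {x y w v : ℚ} → 0ℚ ℚ.≤ w → x ℚ.≤ y → y ℚ.+ w ℚ.≤ x ℚ.+ v → ∣ y ℚ.- x ∣ ℚ.≤ v
  gap-bound {x} {y} {w} {v} 0≤w x≤y h = subst (ℚ._≤ v) (sym (ℚₚ.0≤p⇒∣p∣≡p 0≤y-x))
    (subst₂ ℚ._≤_ (cong (ℚ._- x) (ℚₚ.+-identityʳ y))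
      (solve 2 (λ x v → x :+ v :- x := v) refl x v)
      (ℚₚ.+-monoˡ-≤ (ℚ.- x) (≤-trans (ℚₚ.+-monoʳ-≤ y 0≤w) h)))
    where
    0≤y-x : 0ℚ ℚ.≤ y ℚ.- x
    0≤y-x = subst (ℚ._≤ y ℚ.- x) (ℚₚ.+-inverseʳ x) (ℚₚ.+-monoˡ-≤ (ℚ.- x) x≤y)

  eSeq-cauchy : Cauchy eSeq
  eSeq-cauchy = tail⇒Cauchy eSeq (+ 6 / 1) (ℚₚ.positive⁻¹ (+ 6 / 1)) λ n d →
    subst (∣ eSeq (d ℕ.+ n) ℚ.- eSeq n ∣ ℚ.≤_) (sym (/1-* 6 n))
      (gap-bound {eSeq n} {eSeq (d ℕ.+ n)} {+ 6 / suc (d ℕ.+ n)} {+ 6 / suc n}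
        (/-nonNeg 6 (d ℕ.+ n)) (eSeq-mono d n) (eSeq-tail d n))

  leibnizTail : ℕ → ℕ → ℚ
  leibnizTail n zero    = 0ℚ
  leibnizTail n (suc d) = + 4 / suc (2 ℕ.* n) ℚ.- leibnizTail (suc n) d

  πSeq-split : ∀ d n → πSeq (d ℕ.+ n) ≡ πSeq n ℚ.+ (ℚ.- 1ℚ) ^ n ℚ.* leibnizTail n d
  πSeq-split zero n = sym (trans (cong (πSeq n ℚ.+_) (ℚₚ.*-zeroʳ ((ℚ.- 1ℚ) ^ n)))
    (ℚₚ.+-identityʳ (πSeq n)))
  πSeq-split (suc d) n = trans (cong πSeq (sym (ℕₚ.+-suc d n)))
    (trans (πSeq-split d (suc n))
      (solve 4 (λ p s t r → p :+ s :* t :+ con (ℚ.- 1ℚ) :* s :* r := p :+ s :* (t :- r)) refl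
        (πSeq n) ((ℚ.- 1ℚ) ^ n) (+ 4 / suc (2 ℕ.* n)) (leibnizTail (suc n) d)))

  leibniz-decreasing : ∀ n → + 4 / suc (2 ℕ.* suc n) ℚ.≤ + 4 / suc (2 ℕ.* n)
  leibniz-decreasing n = /-mono 4 (2 ℕ.* suc n) 4 (2 ℕ.* n)
    (ℕₚ.*-monoʳ-≤ 4 (s≤s (ℕₚ.*-monoʳ-≤ 2 (ℕₚ.n≤1+n n))))

  leibnizTail-nonNeg : ∀ n d → 0ℚ ℚ.≤ leibnizTail n d
  leibnizTail-upper  : ∀ n d → leibnizTail n d ℚ.≤ + 4 / suc (2 ℕ.* n)

  leibnizTail-nonNeg n zero    = ℚₚ.≤-refl
  leibnizTail-nonNeg n (suc d) = subst (ℚ._≤ leibnizTail n (suc d))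
    (ℚₚ.+-inverseʳ (leibnizTail (suc n) d))
    (ℚₚ.+-monoˡ-≤ (ℚ.- leibnizTail (suc n) d)
      (≤-trans (leibnizTail-upper (suc n) d) (leibniz-decreasing n)))

  leibnizTail-upper n zero    = /-nonNeg 4 (2 ℕ.* n)
  leibnizTail-upper n (suc d) = subst (leibnizTail n (suc d) ℚ.≤_)
    (ℚₚ.+-identityʳ (+ 4 / suc (2 ℕ.* n)))
    (ℚₚ.+-monoʳ-≤ (+ 4 / suc (2 ℕ.* n))
      (ℚₚ.neg-antimono-≤ (leibnizTail-nonNeg (suc n) d)))

  ∣sign∣≡1 : ∀ n → ∣ (ℚ.- 1ℚ) ^ n ∣ ≡ 1ℚ
  ∣sign∣≡1 zero    = refl
  ∣sign∣≡1 (suc n) = trans (ℚₚ.∣p*q∣≡∣p∣*∣q∣ (ℚ.- 1ℚ) ((ℚ.- 1ℚ) ^ n))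
    (trans (ℚₚ.*-identityˡ ∣ (ℚ.- 1ℚ) ^ n ∣) (∣sign∣≡1 n))

  πSeq-tail : ∀ n d → ∣ πSeq (d ℕ.+ n) ℚ.- πSeq n ∣ ≡ leibnizTail n d
  πSeq-tail n d = trans
    (cong ∣_∣ (trans (cong (ℚ._- πSeq n) (πSeq-split d n))
      (solve 2 (λ p r → p :+ r :- p := r) refl (πSeq n) ((ℚ.- 1ℚ) ^ n ℚ.* leibnizTail n d))))
    (trans (ℚₚ.∣p*q∣≡∣p∣*∣q∣ ((ℚ.- 1ℚ) ^ n) (leibnizTail n d))
      (trans (cong₂ ℚ._*_ (∣sign∣≡1 n) (ℚₚ.0≤p⇒∣p∣≡p (leibnizTail-nonNeg n d)))
        (ℚₚ.*-identityˡ (leibnizTail n d))))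

  πSeq-cauchy : Cauchy πSeq
  πSeq-cauchy = tail⇒Cauchy πSeq (+ 4 / 1) (ℚₚ.positive⁻¹ (+ 4 / 1)) λ n d →
    subst₂ ℚ._≤_ (sym (πSeq-tail n d)) (sym (/1-* 4 n))
      (≤-trans (leibnizTail-upper n d)
        (/-mono 4 (2 ℕ.* n) 4 n (ℕₚ.*-monoʳ-≤ 4 (s≤s (ℕₚ.m≤m+n n (n ℕ.+ 0))))))

e π : ℝ
e .seq    = eSeq
e .cauchy = eSeq-cauchy
π .seq    = πSeq
π .cauchy = πSeq-cauchy

eventually-≥⇒pos : (x : ℝ) (δ : ℚ) → 0ℚ ℚ.< δ → (N : ℕ) →
                   (∀ n → N ℕ.≤ n → δ ℚ.≤ seq x n) → 0ℝ <ℝ x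
eventually-≥⇒pos x δ 0<δ N h = mk<ℝ δ 0<δ N λ n N≤n →
  subst (ℚ._≤ seq x n) (sym (ℚₚ.+-identityˡ δ)) (h n N≤n)

pos⇒eventually-≥ : (x : ℝ) → 0ℝ <ℝ x →
  ∃ λ δ → 0ℚ ℚ.< δ × ∃ λ N → ∀ n → N ℕ.≤ n → δ ℚ.≤ seq x n
pos⇒eventually-≥ x (mk<ℝ δ 0<δ N h) = δ , 0<δ , N , λ n N≤n →
  subst (ℚ._≤ seq x n) (ℚₚ.+-identityˡ δ) (h n N≤n)

abstract

  fromℕ-pos : ∀ n → 0 ℕ.< n → 0ℝ <ℝ fromℕ n
  fromℕ-pos (suc n) _ = eventually-≥⇒pos (fromℕ (suc n)) (+ suc n / 1) (/-pos n 0) 0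
    λ _ _ → ℚₚ.≤-refl

  e-pos : 0ℝ <ℝ e
  e-pos = eventually-≥⇒pos e 1ℚ 0<1 1 λ n 1≤n →
    subst (λ i → 1ℚ ℚ.≤ eSeq i) (ℕₚ.m∸n+n≡m 1≤n) (eSeq-mono (n ℕ.∸ 1) 1)

  π-pos : 0ℝ <ℝ π
  π-pos = eventually-≥⇒pos π 1ℚ 0<1 1 λ n 1≤n →
    subst (λ i → 1ℚ ℚ.≤ πSeq i) (ℕₚ.m∸n+n≡m 1≤n) (lower (n ℕ.∸ 1))
    where
    lower : ∀ d → 1ℚ ℚ.≤ πSeq (d ℕ.+ 1)
    lower d = subst (1ℚ ℚ.≤_) (sym (πSeq-split d 1))
      (subst (λ t → 1ℚ ℚ.≤ πSeq 1 ℚ.+ t)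
        (solve 1 (λ r → :- r := con (ℚ.- 1ℚ) :* r) refl (leibnizTail 1 d))
        (ℚₚ.+-monoʳ-≤ (πSeq 1) (ℚₚ.neg-antimono-≤
          (≤-trans (leibnizTail-upper 1 d) (/-mono 4 2 3 0 (ℕₚ.m≤m+n 4 5))))))

  *-posℝ : (x y : ℝ) → 0ℝ <ℝ x → 0ℝ <ℝ y → 0ℝ <ℝ x *ℝ y
  *-posℝ x y 0<x 0<y =
    let δ , 0<δ , M , hx = pos⇒eventually-≥ x 0<x
        η , 0<η , N , hy = pos⇒eventually-≥ y 0<y
    in eventually-≥⇒pos (x *ℝ y) (δ ℚ.* η) (*-pos 0<δ 0<η) (M ℕ.⊔ N) λ n n≥ →
      *-mono (<⇒≤ 0<δ) (hx n (ℕₚ.m⊔n≤o⇒m≤o M N n≥)) (<⇒≤ 0<η) (hy n (ℕₚ.m⊔n≤o⇒n≤o M N n≥))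

  ^-posℝ : (x : ℝ) (n : ℕ) → 0ℝ <ℝ x → 0ℝ <ℝ x ^ℝ n
  ^-posℝ x zero    _   = eventually-≥⇒pos 1ℝ 1ℚ 0<1 0 λ _ _ → ℚₚ.≤-refl
  ^-posℝ x (suc n) 0<x = *-posℝ x (x ^ℝ n) 0<x (^-posℝ x n 0<x)

  inv-pos : (x : ℝ) (0<x : 0ℝ <ℝ x) → 0ℝ <ℝ invℝ x 0<x
  inv-pos x 0<x =
    let δ , 0<δ , M , hx = pos⇒eventually-≥ x 0<x
        B , 0<B , N , hB = eventually-bounded (seq x) (cauchy x)
    in eventually-≥⇒pos (invℝ x 0<x) (recip B) (recip-pos B 0<B) (M ℕ.⊔ N) λ n n≥ →
      recip-anti (seq x n) B (<-≤-trans 0<δ (hx n (ℕₚ.m⊔n≤o⇒m≤o M N n≥)))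
        (≤-trans (p≤∣p∣ (seq x n)) (hB n (ℕₚ.m⊔n≤o⇒n≤o M N n≥)))

  p^≤p : ∀ m → 0ℚ ℚ.≤ p → p ℚ.≤ 1ℚ → p ^ suc m ℚ.≤ p
  p^≤p {p} m 0≤p p≤1 = subst (p ^ suc m ℚ.≤_) (ℚₚ.*-identityʳ p)
    (*-monoˡ 0≤p (subst (p ^ m ℚ.≤_) (^-one m) (^-mono m 0≤p p≤1)))

  root-pos : (m : ℕ) .{{_ : ℕ.NonZero m}} (x : ℝ) → 0ℝ <ℝ x → 0ℝ <ℝ root m x
  root-pos (suc m) x 0<x =
    let δ , 0<δ , M , hx = pos⇒eventually-≥ x 0<x
        c : ℚ
        c = δ ℚ.⊓ 1ℚ
        0<c : 0ℚ ℚ.< c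
        0<c = [ (λ eq → subst (0ℚ ℚ.<_) (sym eq) 0<δ)
              , (λ eq → subst (0ℚ ℚ.<_) (sym eq) 0<1) ]′ (ℚₚ.⊓-sel δ 1ℚ)
        h : ℚ
        h = ½ ℚ.* c
        K , small = archimedean h (0<½* {c} 0<c)
    in eventually-≥⇒pos (root (suc m) x) h (0<½* {c} 0<c) (M ℕ.⊔ K) λ n n≥ →
      step m (seq x n) δ c n (<⇒≤ 0<c) (ℚₚ.p⊓q≤p δ 1ℚ) (ℚₚ.p⊓q≤q δ 1ℚ)
        (hx n (ℕₚ.m⊔n≤o⇒m≤o M K n≥)) (small n (ℕₚ.m⊔n≤o⇒n≤o M K n≥))
    where
    step : ∀ m y δ c n → 0ℚ ℚ.≤ c → c ℚ.≤ δ → c ℚ.≤ 1ℚ → δ ℚ.≤ y → + 1 / suc n ℚ.< ½ ℚ.* c →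
           ½ ℚ.* c ℚ.≤ rootApprox (suc m) n y
    step m y δ c n 0≤c c≤δ c≤1 δ≤y t<h = ℚₚ.≮⇒≥ λ u<h →
      <⇒≱ (rootApprox-upper m n y)
        (≤-trans
          (^-mono (suc m)
            (+-nonNeg {rootApprox (suc m) n y} {+ 1 / suc n}
              (rootApprox-nonNeg (suc m) n y) (/-nonNeg 1 n))
            (subst (rootApprox (suc m) n y ℚ.+ + 1 / suc n ℚ.≤_) (halves c)
              (<⇒≤ (ℚₚ.+-mono-< u<h t<h))))
          (≤-trans (p^≤p {c} m 0≤c c≤1)
            (≤-trans c≤δ (≤-trans δ≤y (ℚₚ.p≤p⊔q y 0ℚ)))))

  ^[/]-pos : (x : ℝ) (p q : ℕ) .{{_ : ℕ.NonZero q}} → 0ℝ <ℝ x → 0ℝ <ℝ x ^[ p / q ]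
  ^[/]-pos x p q 0<x = root-pos q (x ^ℝ p) (^-posℝ x p 0<x)

record ℂ : Set where
  no-eta-equality
  field
    re im : ℝ

open ℂ public

infix  4 _≈ℂ_
infixl 6 _+ℂ_ _-ℂ_
infixl 7 _*ℂ_
infix  8 -ℂ_

record _≈ℂ_ (z w : ℂ) : Set where
  constructor mk≈ℂ
  field
    re-≈ : re z ≈ℝ re w
    im-≈ : im z ≈ℝ im w

0ℂ 1ℂ : ℂ
0ℂ .re = 0ℝ
0ℂ .im = 0ℝ
1ℂ .re = 1ℝ
1ℂ .im = 0ℝ

-ℂ_ : ℂ → ℂ
(-ℂ z) .re = -ℝ re z
(-ℂ z) .im = -ℝ im z

_+ℂ_ _*ℂ_ _-ℂ_ : ℂ → ℂ → ℂ
(z +ℂ w) .re = re z +ℝ re w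
(z +ℂ w) .im = im z +ℝ im w
(z *ℂ w) .re = re z *ℝ re w +ℝ (-ℝ (im z *ℝ im w))
(z *ℂ w) .im = re z *ℝ im w +ℝ im z *ℝ re w
z -ℂ w = z +ℂ (-ℂ w)

∣_∣ℂ : ℂ → ℝ
∣ z ∣ℂ = root 2 (re z *ℝ re z +ℝ im z *ℝ im z)

ℂ-rawRing : RawRing 0ℓ 0ℓ
ℂ-rawRing = record
  { Carrier = ℂ ; _≈_ = _≈ℂ_ ; _+_ = _+ℂ_ ; _*_ = _*ℂ_ ; -_ = -ℂ_ ; 0# = 0ℂ ; 1# = 1ℂ }

open RawSemiringDefs (RawRing.rawSemiring ℂ-rawRing) public
  using () renaming (_^_ to infixr 8 _^ℂ_; sum to ∑ℂ; product to ∏ℂ)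

fibPoly : ℕ → ℂ → ℂ
fibPoly k X = X ^ℂ k -ℂ ∑ℂ {k} (λ i → X ^ℂ toℕ i)

-- α lists the complex roots of fibPoly k, with multiplicity. Equality of the two
-- monic polynomials is expressed as equality of functions on ℂ.
AreRootsOfFib : (k : ℕ) → (Fin k → ℂ) → Set
AreRootsOfFib k α = ∀ X → fibPoly k X ≈ℂ ∏ℂ (λ i → X -ℂ α i)

π/e : ℝ
π/e = π *ℝ invℝ e e-pos

-- 6.6 = 33 / 5.
separationDenominator-pos : ∀ k → 4 ℕ.≤ k →
  0ℝ <ℝ fromℕ k ^[ 33 / 5 ] *ℝ π/e ^ℝ k
separationDenominator-pos k 4≤k =
  *-posℝ (fromℕ k ^[ 33 / 5 ]) (π/e ^ℝ k)
    (^[/]-pos (fromℕ k) 33 5 (fromℕ-pos k (ℕₚ.≤-trans (s≤s z≤n) 4≤k)))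
    (^-posℝ π/e k (*-posℝ π (invℝ e e-pos) π-pos (inv-pos e e-pos)))

{-# OPTIONS --safe #-}
module Submission where

-- Put g(x) = (x - 1) f(x) = 1 - x ^ k (2 - x), and D(x, a) = ∑ x ^ i a ^ (k - 1 - i).
-- If a and b are two entries of the list of roots, then (x - a) (x - b) divides g, and cancelling
-- x - a from a ^ k g(x) = (x - a) ((a x) ^ k - D(x, a)) at x = b gives (a b) ^ k = D(a, b).
-- As |a| ^ k |2 - a| = 1, either |a| ≤ 1 or a is close to 2. In the first case D(a, b) is within
-- O(k ^ 2 |a - b|) of k a ^ (k - 1), which exceeds |a b| ^ k by a constant factor since
-- |a| ^ k ≥ 1 / 3; in the second |a b| ^ k exceeds k max(|a|, |b|) ^ (k - 1) if b is near a.
-- Hence |a - b| ≥ 1 / (40 k ^ 2), which is ample because π > 3 > e.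
--
-- All estimates are made on the rational approximations of the roots at one large index, with b
-- replaced by b ± δ so that x - a can be cancelled even if a and b coincide.

-- Arithmetic on `ℝ` and `ℂ` is termwise, so taking the approximations at one index n is an exact
-- ring homomorphism to the Gaussian rationals. The only inexact input is f(X) = ∏ (X - α l), which
-- holds at index n up to a chosen tolerance, and only for points X fixed before n. The identities
-- of the overview therefore reappear with error terms: u = g(a), and T, the amount by which (a x) ^
-- k = (1 - u) D(x, a) fails. Both, and |x - b|, are kept below t / 1000, where t = 1 / k ^ 2.
--
-- The case |a| ≤ 1 needs no lower bound for |a|. Multiplying D(a, a) = k a ^ (k - 1) by a (2 - a)
-- turns it into k a ^ k (2 - a), which is k when g(a) = 0, whereas a (2 - a) (a b) ^ k is at most
-- about 3. So k ≥ 4 leaves room for all the errors.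

module Separation where

  open import Algebra.Bundles using (CommutativeRing; Semiring)
  import Algebra.Definitions.RawSemiring as RawSemiringDefs
  import Algebra.Properties.CommutativeSemiring.Exp as Exp
  import Algebra.Properties.Semiring.Sum as Sum
  import Algebra.Solver.Ring.AlmostCommutativeRing as ACR
  import Algebra.Solver.Ring.Simple as RingSolver
  open import Algebra.Structures using (IsCommutativeRing)
  open import Data.Empty using (⊥)
  open import Data.Fin as Fin using (Fin; zero; suc; toℕ)
  open import Data.Integer using (+_)
  open import Data.Nat as ℕ using (ℕ; zero; suc; z≤n; s≤s)
  import Data.Nat.Properties as ℕₚ
  open import Data.Product using (∃; _×_; _,_; proj₁; proj₂)
  open import Data.Rational as ℚ
    using (ℚ; 0ℚ; 1ℚ; ½; _+_; _*_; -_; _-_; _≤_; _<_; ∣_∣; _/_)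
  open import Data.Rational.Properties as ℚₚ
    using (≤-trans; ≤-refl; ≤-reflexive; <⇒≤; <-≤-trans; ≤-<-trans; module ≤-Reasoning)
  open import Data.Rational.Solver using (module +-*-Solver)
  open import Data.Sum using (inj₁; inj₂)
  open import Defs
  open import Level using (0ℓ)
  open import Relation.Binary.PropositionalEquality
    using (_≡_; refl; sym; trans; cong; cong₂; subst; subst₂; isEquivalence; module ≡-Reasoning)
  open import Relation.Nullary using (Dec; yes; no)
  open import Relation.Nullary.Decidable using (True; toWitness; map′; _×-dec_)

  open +-*-Solver using (solve; _:=_; _:+_; _:*_; _:-_; :-_; con)
  open RawSemiringDefs ℚ.+-*-rawSemiring using (_^_)
  open Exp (CommutativeRing.commutativeSemiring ℚₚ.+-*-commutativeRing)
    using (^-homo-*; ^-assocʳ)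

  private
    variable
      p q r s c h ε : ℚ

  -- The commutative ring of Gaussian rationals

  infixl 6 _+ᵍ_ _-ᵍ_
  infixl 7 _*ᵍ_
  infix  8 -ᵍ_

  record ℚ[i] : Set where
    constructor gauss
    field
      ℜ ℑ : ℚ

  open ℚ[i]

  _+ᵍ_ _*ᵍ_ : ℚ[i] → ℚ[i] → ℚ[i]
  z +ᵍ w = gauss (ℜ z + ℜ w) (ℑ z + ℑ w)
  z *ᵍ w = gauss (ℜ z * ℜ w + - (ℑ z * ℑ w)) (ℜ z * ℑ w + ℑ z * ℜ w)

  -ᵍ_ : ℚ[i] → ℚ[i]
  -ᵍ z = gauss (- ℜ z) (- ℑ z)

  _-ᵍ_ : ℚ[i] → ℚ[i] → ℚ[i]
  z -ᵍ w = z +ᵍ (-ᵍ w)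

  real : ℚ → ℚ[i]
  real q = gauss q 0ℚ

  _≟ᵍ_ : (z w : ℚ[i]) → Dec (z ≡ w)
  gauss p q ≟ᵍ gauss r s = map′ (λ { (refl , refl) → refl }) (λ { refl → refl , refl })
    (p ℚₚ.≟ r ×-dec q ℚₚ.≟ s)

  abstract
    ℚ[i]-isCommutativeRing : IsCommutativeRing _≡_ _+ᵍ_ _*ᵍ_ (λ z → -ᵍ z) (real 0ℚ) (real 1ℚ)
    ℚ[i]-isCommutativeRing = record
      { isRing = record
        { +-isAbelianGroup = record
          { isGroup = record
            { isMonoid = record
              { isSemigroup = record
                { isMagma = record { isEquivalence = isEquivalence ; ∙-cong = cong₂ _+ᵍ_ }
                ; assoc = λ x y z → cong₂ gauss (ℚₚ.+-assoc (ℜ x) (ℜ y) (ℜ z)) (ℚₚ.+-assoc (ℑ x) (ℑ y) (ℑ z))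
                }
              ; identity = (λ x → cong₂ gauss (ℚₚ.+-identityˡ (ℜ x)) (ℚₚ.+-identityˡ (ℑ x)))
                         , (λ x → cong₂ gauss (ℚₚ.+-identityʳ (ℜ x)) (ℚₚ.+-identityʳ (ℑ x)))
              }
            ; inverse = (λ x → cong₂ gauss (ℚₚ.+-inverseˡ (ℜ x)) (ℚₚ.+-inverseˡ (ℑ x)))
                      , (λ x → cong₂ gauss (ℚₚ.+-inverseʳ (ℜ x)) (ℚₚ.+-inverseʳ (ℑ x)))
            ; ⁻¹-cong = cong (λ z → -ᵍ z)
            }
          ; comm = λ x y → cong₂ gauss (ℚₚ.+-comm (ℜ x) (ℜ y)) (ℚₚ.+-comm (ℑ x) (ℑ y))
          }
        ; *-cong = cong₂ _*ᵍ_
        ; *-assoc = λ { (gauss a b) (gauss c d) (gauss e f) → cong₂ gauss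
            (solve 6 (λ a b c d e f → (a :* c :+ (:- (b :* d))) :* e :+ (:- ((a :* d :+ b :* c) :* f))
              := a :* (c :* e :+ (:- (d :* f))) :+ (:- (b :* (c :* f :+ d :* e)))) refl a b c d e f)
            (solve 6 (λ a b c d e f → (a :* c :+ (:- (b :* d))) :* f :+ (a :* d :+ b :* c) :* e
              := a :* (c :* f :+ d :* e) :+ b :* (c :* e :+ (:- (d :* f)))) refl a b c d e f) }
        ; *-identity = (λ { (gauss a b) → cong₂ gauss
              (solve 2 (λ a b → con 1ℚ :* a :+ (:- (con 0ℚ :* b)) := a) refl a b)
              (solve 2 (λ a b → con 1ℚ :* b :+ con 0ℚ :* a := b) refl a b) })
            , (λ { (gauss a b) → cong₂ gauss
              (solve 2 (λ a b → a :* con 1ℚ :+ (:- (b :* con 0ℚ)) := a) refl a b)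
              (solve 2 (λ a b → a :* con 0ℚ :+ b :* con 1ℚ := b) refl a b) })
        ; distrib = (λ { (gauss a b) (gauss c d) (gauss e f) → cong₂ gauss
              (solve 6 (λ a b c d e f → a :* (c :+ e) :+ (:- (b :* (d :+ f)))
                := a :* c :+ (:- (b :* d)) :+ (a :* e :+ (:- (b :* f)))) refl a b c d e f)
              (solve 6 (λ a b c d e f → a :* (d :+ f) :+ b :* (c :+ e)
                := a :* d :+ b :* c :+ (a :* f :+ b :* e)) refl a b c d e f) })
            , (λ { (gauss a b) (gauss c d) (gauss e f) → cong₂ gauss
              (solve 6 (λ a b c d e f → (c :+ e) :* a :+ (:- ((d :+ f) :* b))
                := c :* a :+ (:- (d :* b)) :+ (e :* a :+ (:- (f :* b)))) refl a b c d e f)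
              (solve 6 (λ a b c d e f → (c :+ e) :* b :+ (d :+ f) :* a
                := c :* b :+ d :* a :+ (e :* b :+ f :* a)) refl a b c d e f) })
        }
      ; *-comm = λ { (gauss a b) (gauss c d) → cong₂ gauss
          (solve 4 (λ a b c d → a :* c :+ (:- (b :* d)) := c :* a :+ (:- (d :* b))) refl a b c d)
          (solve 4 (λ a b c d → a :* d :+ b :* c := c :* b :+ d :* a) refl a b c d) }
      }

  ℚ[i]-commutativeRing : CommutativeRing 0ℓ 0ℓ
  ℚ[i]-commutativeRing = record { isCommutativeRing = ℚ[i]-isCommutativeRing }

  module ℚ[i]ᵣ = CommutativeRing ℚ[i]-commutativeRing
  module S = RingSolver (ACR.fromCommutativeRing ℚ[i]-commutativeRing) _≟ᵍ_

  open Exp ℚ[i]ᵣ.commutativeSemiring using () renaming (_^_ to infixr 8 _^ᵍ_)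
  open Sum ℚ[i]ᵣ.semiring using () renaming (sum to ∑ᵍ; *-distribˡ-sum to *ᵍ-distribˡ-∑ᵍ)
  open RawSemiringDefs (Semiring.rawSemiring ℚ[i]ᵣ.semiring) using () renaming (product to ∏ᵍ)

  private
    variable
      z w : ℚ[i]

  1ᵍ 2ᵍ : ℚ[i]
  1ᵍ = real 1ℚ
  2ᵍ = 1ᵍ +ᵍ 1ᵍ

  -- Polynomial identities

  fibᵍ : ℕ → ℚ[i] → ℚ[i]
  fibᵍ k x = x ^ᵍ k -ᵍ ∑ᵍ {k} (λ i → x ^ᵍ toℕ i)

  -- (x - 1) (x ^ k - ⋯ - x - 1).
  sparse : ℕ → ℚ[i] → ℚ[i]
  sparse k x = 1ᵍ -ᵍ x ^ᵍ k *ᵍ (2ᵍ -ᵍ x)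

  -- (x ^ k - a ^ k) / (x - a).
  quotient : ℕ → ℚ[i] → ℚ[i] → ℚ[i]
  quotient zero    x a = real 0ℚ
  quotient (suc k) x a = x ^ᵍ k +ᵍ a *ᵍ quotient k x a

  -- The cofactor of x - a in a ^ k (sparse k x - sparse k a); for a root a it is (a x) ^ k - quotient k x a.
  obstruction : ℕ → ℚ[i] → ℚ[i] → ℚ[i]
  obstruction k x a = a ^ᵍ k *ᵍ (x ^ᵍ k -ᵍ (2ᵍ -ᵍ a) *ᵍ quotient k x a)

  abstract
    geometric-sum : ∀ k x → (x -ᵍ 1ᵍ) *ᵍ ∑ᵍ {k} (λ i → x ^ᵍ toℕ i) ≡ x ^ᵍ k -ᵍ 1ᵍ
    geometric-sum zero    x = S.solve 1 (λ x → (x S.:- S.con 1ᵍ) S.:* S.con (real 0ℚ)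
      S.:= S.con 1ᵍ S.:- S.con 1ᵍ) refl x
    geometric-sum (suc k) x = begin
      (x -ᵍ 1ᵍ) *ᵍ (1ᵍ +ᵍ ∑ᵍ {k} (λ i → x *ᵍ x ^ᵍ toℕ i))
        ≡⟨ cong (λ t → (x -ᵍ 1ᵍ) *ᵍ (1ᵍ +ᵍ t)) (sym (*ᵍ-distribˡ-∑ᵍ x (λ (i : Fin k) → x ^ᵍ toℕ i))) ⟩
      (x -ᵍ 1ᵍ) *ᵍ (1ᵍ +ᵍ x *ᵍ σ)
        ≡⟨ S.solve 2 (λ x σ → (x S.:- S.con 1ᵍ) S.:* (S.con 1ᵍ S.:+ x S.:* σ)
             S.:= (x S.:- S.con 1ᵍ) S.:+ x S.:* ((x S.:- S.con 1ᵍ) S.:* σ)) refl x σ ⟩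
      (x -ᵍ 1ᵍ) +ᵍ x *ᵍ ((x -ᵍ 1ᵍ) *ᵍ σ)
        ≡⟨ cong (λ t → (x -ᵍ 1ᵍ) +ᵍ x *ᵍ t) (geometric-sum k x) ⟩
      (x -ᵍ 1ᵍ) +ᵍ x *ᵍ (x ^ᵍ k -ᵍ 1ᵍ)
        ≡⟨ S.solve 2 (λ x p → (x S.:- S.con 1ᵍ) S.:+ x S.:* (p S.:- S.con 1ᵍ)
             S.:= x S.:* p S.:- S.con 1ᵍ) refl x (x ^ᵍ k) ⟩
      x ^ᵍ suc k -ᵍ 1ᵍ ∎
      where
      open ≡-Reasoning
      σ : ℚ[i]
      σ = ∑ᵍ {k} (λ i → x ^ᵍ toℕ i)

    fib-sparse : ∀ k x → (x -ᵍ 1ᵍ) *ᵍ fibᵍ k x ≡ sparse k x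
    fib-sparse k x = trans
      (S.solve 3 (λ x p σ → (x S.:- S.con 1ᵍ) S.:* (p S.:- σ)
        S.:= (x S.:- S.con 1ᵍ) S.:* p S.:- (x S.:- S.con 1ᵍ) S.:* σ) refl x (x ^ᵍ k) σ)
      (trans (cong (λ t → (x -ᵍ 1ᵍ) *ᵍ x ^ᵍ k -ᵍ t) (geometric-sum k x))
        (S.solve 2 (λ x p → (x S.:- S.con 1ᵍ) S.:* p S.:- (p S.:- S.con 1ᵍ)
          S.:= S.con 1ᵍ S.:- p S.:* (S.con 1ᵍ S.:+ S.con 1ᵍ S.:- x)) refl x (x ^ᵍ k)))
      where
      σ : ℚ[i]
      σ = ∑ᵍ {k} (λ i → x ^ᵍ toℕ i)

    quotient-* : ∀ k x a → (x -ᵍ a) *ᵍ quotient k x a ≡ x ^ᵍ k -ᵍ a ^ᵍ k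
    quotient-* zero    x a = S.solve 2 (λ x a → (x S.:- a) S.:* S.con (real 0ℚ)
      S.:= S.con 1ᵍ S.:- S.con 1ᵍ) refl x a
    quotient-* (suc k) x a = trans
      (S.solve 4 (λ x a p d → (x S.:- a) S.:* (p S.:+ a S.:* d)
        S.:= (x S.:- a) S.:* p S.:+ a S.:* ((x S.:- a) S.:* d)) refl x a (x ^ᵍ k) (quotient k x a))
      (trans (cong (λ t → (x -ᵍ a) *ᵍ x ^ᵍ k +ᵍ a *ᵍ t) (quotient-* k x a))
        (S.solve 4 (λ x a p q → (x S.:- a) S.:* p S.:+ a S.:* (p S.:- q)
          S.:= x S.:* p S.:- a S.:* q) refl x a (x ^ᵍ k) (a ^ᵍ k)))

    obstruction-* : ∀ k x a →
      obstruction k x a *ᵍ (x -ᵍ a) ≡ a ^ᵍ k *ᵍ (sparse k x -ᵍ sparse k a)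
    obstruction-* k x a = trans
      (S.solve 5 (λ x a p q d → q S.:* (p S.:- (two S.:- a) S.:* d) S.:* (x S.:- a)
        S.:= q S.:* (p S.:* (x S.:- a) S.:- (two S.:- a) S.:* ((x S.:- a) S.:* d)))
        refl x a (x ^ᵍ k) (a ^ᵍ k) (quotient k x a))
      (trans (cong (λ t → a ^ᵍ k *ᵍ (x ^ᵍ k *ᵍ (x -ᵍ a) -ᵍ (2ᵍ -ᵍ a) *ᵍ t)) (quotient-* k x a))
        (S.solve 4 (λ x a p q → q S.:* (p S.:* (x S.:- a) S.:- (two S.:- a) S.:* (p S.:- q))
          S.:= q S.:* ((S.con 1ᵍ S.:- p S.:* (two S.:- x)) S.:- (S.con 1ᵍ S.:- q S.:* (two S.:- a))))
          refl x a (x ^ᵍ k) (a ^ᵍ k)))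
      where
      two : ∀ {n} → S.Polynomial n
      two = S.con 1ᵍ S.:+ S.con 1ᵍ

    quotient-perturb : ∀ k x a → quotient (suc k) x a -ᵍ quotient (suc k) a a
      ≡ (x -ᵍ a) *ᵍ quotient k x a +ᵍ a *ᵍ (quotient k x a -ᵍ quotient k a a)
    quotient-perturb k x a = trans
      (S.solve 5 (λ p q a d e → (p S.:+ a S.:* d) S.:- (q S.:+ a S.:* e)
        S.:= (p S.:- q) S.:+ a S.:* (d S.:- e)) refl
        (x ^ᵍ k) (a ^ᵍ k) a (quotient k x a) (quotient k a a))
      (cong (_+ᵍ a *ᵍ (quotient k x a -ᵍ quotient k a a)) (sym (quotient-* k x a)))

  -- Squared norms and discs

  norm : ℚ[i] → ℚ
  norm z = ℜ z * ℜ z + ℑ z * ℑ z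

  abstract
    -- p ≤ q from q = p + r with r visibly nonnegative, the identity being left to the ring solver.
    slack : 0ℚ ≤ r → q ≡ p + r → p ≤ q
    slack {r} {q} {p} 0≤r eq = subst₂ _≤_ (ℚₚ.+-identityʳ p) (sym eq) (ℚₚ.+-monoʳ-≤ p 0≤r)

    square-nonNeg : ∀ p → 0ℚ ≤ p * p
    square-nonNeg p with ℚₚ.≤-total 0ℚ p
    ... | inj₁ 0≤p = *-nonNeg 0≤p 0≤p
    ... | inj₂ p≤0 = subst (0ℚ ≤_) (solve 1 (λ p → (:- p) :* (:- p) := p :* p) refl p)
      (*-nonNeg (ℚₚ.neg-antimono-≤ p≤0) (ℚₚ.neg-antimono-≤ p≤0))

    square-mono : 0ℚ ≤ p → p ≤ q → p * p ≤ q * q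
    square-mono 0≤p p≤q = *-mono 0≤p p≤q 0≤p p≤q

    square-mono-< : 0ℚ ≤ p → p < q → p * p < q * q
    square-mono-< {p} {q} 0≤p p<q = ≤-<-trans (*-monoˡ 0≤p (<⇒≤ p<q))
      (subst₂ _<_ (ℚₚ.*-comm q p) refl (*-monoˡ-< (≤-<-trans 0≤p p<q) p<q))

    square-cancel : 0ℚ ≤ q → p * p ≤ q * q → p ≤ q
    square-cancel 0≤q pp≤qq = ℚₚ.≮⇒≥ λ q<p → <⇒≱ (square-mono-< 0≤q q<p) pp≤qq

    norm-nonNeg : ∀ z → 0ℚ ≤ norm z
    norm-nonNeg (gauss a b) = +-nonNeg (square-nonNeg a) (square-nonNeg b)

    norm-* : ∀ z w → norm (z *ᵍ w) ≡ norm z * norm w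
    norm-* (gauss a b) (gauss c d) = solve 4 (λ a b c d →
      (a :* c :+ (:- (b :* d))) :* (a :* c :+ (:- (b :* d))) :+ (a :* d :+ b :* c) :* (a :* d :+ b :* c)
        := (a :* a :+ b :* b) :* (c :* c :+ d :* d)) refl a b c d

    norm-^ : ∀ z n → norm (z ^ᵍ n) ≡ norm z ^ n
    norm-^ z zero    = refl
    norm-^ z (suc n) = trans (norm-* z (z ^ᵍ n)) (cong (norm z *_) (norm-^ z n))

    norm-neg : ∀ z → norm (-ᵍ z) ≡ norm z
    norm-neg (gauss a b) = solve 2 (λ a b → (:- a) :* (:- a) :+ (:- b) :* (:- b) := a :* a :+ b :* b) refl a b

    norm-real : ∀ q → norm (real q) ≡ q * q
    norm-real q = solve 1 (λ q → q :* q :+ con 0ℚ :* con 0ℚ := q :* q) refl q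

    norm-+ : ∀ z w → norm (z +ᵍ w) ≤ norm z + norm z + (norm w + norm w)
    norm-+ (gauss a b) (gauss c d) = slack
      (+-nonNeg (square-nonNeg (a - c)) (square-nonNeg (b - d)))
      (solve 4 (λ a b c d → (a :* a :+ b :* b) :+ (a :* a :+ b :* b) :+ ((c :* c :+ d :* d) :+ (c :* c :+ d :* d))
        := (a :+ c) :* (a :+ c) :+ (b :+ d) :* (b :+ d) :+ ((a :- c) :* (a :- c) :+ (b :- d) :* (b :- d)))
        refl a b c d)

  infix 4 _≼_

  -- Membership in a disc about 0, stated with squares so that no square root is ever taken. The
  -- sign of the radius is what lets a square be cancelled.
  record _≼_ (z : ℚ[i]) (r : ℚ) : Set where
    constructor mk≼
    field
      radius-nonNeg : 0ℚ ≤ r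
      norm-≤        : norm z ≤ r * r

  open _≼_

  abstract
    ≼-mono : z ≼ r → r ≤ s → z ≼ s
    ≼-mono (mk≼ 0≤r h) r≤s = mk≼ (≤-trans 0≤r r≤s) (≤-trans h (square-mono 0≤r r≤s))

    ≼-+ : z ≼ r → w ≼ s → z +ᵍ w ≼ r + s
    ≼-+ {gauss a b} {r} {gauss c d} {s} (mk≼ 0≤r hz) (mk≼ 0≤s hw) = mk≼ (+-nonNeg 0≤r 0≤s) (begin
      (a + c) * (a + c) + (b + d) * (b + d)
        ≡⟨ solve 4 (λ a b c d → (a :+ c) :* (a :+ c) :+ (b :+ d) :* (b :+ d)
            := (a :* a :+ b :* b) :+ (c :* c :+ d :* d)
               :+ ((a :* c :+ b :* d) :+ (a :* c :+ b :* d))) refl a b c d ⟩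
      (a * a + b * b) + (c * c + d * d) + (inner + inner)
        ≤⟨ ℚₚ.+-mono-≤ (ℚₚ.+-mono-≤ hz hw) (ℚₚ.+-mono-≤ cauchy-schwarz cauchy-schwarz) ⟩
      r * r + s * s + (r * s + r * s)
        ≡⟨ solve 2 (λ r s → r :* r :+ s :* s :+ (r :* s :+ r :* s) := (r :+ s) :* (r :+ s)) refl r s ⟩
      (r + s) * (r + s) ∎)
      where
      open ≤-Reasoning
      inner : ℚ
      inner = a * c + b * d
      cauchy-schwarz : inner ≤ r * s
      cauchy-schwarz = square-cancel (*-nonNeg 0≤r 0≤s) (begin
        inner * inner
          -- Lagrange's identity.
          ≤⟨ slack (square-nonNeg (a * d - b * c))
               (solve 4 (λ a b c d → (a :* a :+ b :* b) :* (c :* c :+ d :* d)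
                 := (a :* c :+ b :* d) :* (a :* c :+ b :* d) :+ (a :* d :- b :* c) :* (a :* d :- b :* c))
                 refl a b c d) ⟩
        (a * a + b * b) * (c * c + d * d)
          ≤⟨ *-mono (norm-nonNeg (gauss a b)) hz (norm-nonNeg (gauss c d)) hw ⟩
        (r * r) * (s * s)
          ≡⟨ solve 2 (λ r s → (r :* r) :* (s :* s) := (r :* s) :* (r :* s)) refl r s ⟩
        (r * s) * (r * s) ∎)

    ≼-neg : z ≼ r → -ᵍ z ≼ r
    ≼-neg {z} {r} (mk≼ 0≤r h) = mk≼ 0≤r (subst (_≤ r * r) (sym (norm-neg z)) h)

    ≼-minus : z ≼ r → w ≼ s → z -ᵍ w ≼ r + s
    ≼-minus hz hw = ≼-+ hz (≼-neg hw)

    ≼-swap : z -ᵍ w ≼ r → w -ᵍ z ≼ r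
    ≼-swap {z} {w} {r} h = subst (_≼ r) (S.solve 2 (λ z w → S.:- (z S.:- w) S.:= w S.:- z) refl z w) (≼-neg h)

    ≼-triangle : ∀ {u} → z -ᵍ w ≼ r → w -ᵍ u ≼ s → z -ᵍ u ≼ r + s
    ≼-triangle {z} {w} {r} {s} {u} h k = subst (_≼ r + s)
      (S.solve 3 (λ z w u → (z S.:- w) S.:+ (w S.:- u) S.:= z S.:- u) refl z w u) (≼-+ h k)

    ≼-shift : z -ᵍ w ≼ r → w ≼ s → z ≼ r + s
    ≼-shift {z} {w} {r} {s} h k = subst (_≼ r + s)
      (S.solve 2 (λ z w → (z S.:- w) S.:+ w S.:= z) refl z w) (≼-+ h k)

    ≼-* : z ≼ r → w ≼ s → z *ᵍ w ≼ r * s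
    ≼-* {z} {r} {w} {s} (mk≼ 0≤r hz) (mk≼ 0≤s hw) = mk≼ (*-nonNeg 0≤r 0≤s)
      (subst₂ _≤_ (sym (norm-* z w))
        (solve 2 (λ r s → (r :* r) :* (s :* s) := (r :* s) :* (r :* s)) refl r s)
        (*-mono (norm-nonNeg z) hz (norm-nonNeg w) hw))

    ≼-real : 0ℚ ≤ q → real q ≼ q
    ≼-real {q} 0≤q = mk≼ 0≤q (≤-reflexive (norm-real q))

    ≼-1 : 1ᵍ ≼ 1ℚ
    ≼-1 = ≼-real 0≤1

    ≼-^ : ∀ n → z ≼ r → z ^ᵍ n ≼ r ^ n
    ≼-^ zero    h = ≼-1
    ≼-^ (suc n) h = ≼-* h (≼-^ n h)

    norm-<⇒≼ : 0ℚ ≤ r → norm z < r * r → z ≼ r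
    norm-<⇒≼ 0≤r h = mk≼ 0≤r (<⇒≤ h)

    ≼⇒≤ : s * s ≤ norm z → z ≼ r → s ≤ r
    ≼⇒≤ h (mk≼ 0≤r g) = square-cancel 0≤r (≤-trans h g)

    real-≼⇒≤ : real q ≼ r → q ≤ r
    real-≼⇒≤ {q} = ≼⇒≤ (≤-reflexive (sym (norm-real q)))

    norm-∏-≤ : ∀ {k} {C} (y : Fin k → ℚ[i]) → 1ℚ ≤ C → (∀ l → norm (y l) ≤ C) → norm (∏ᵍ y) ≤ C ^ k
    norm-∏-≤ {zero}  y 1≤C h = ≤-refl
    norm-∏-≤ {suc k} {C} y 1≤C h = subst (_≤ C ^ suc k) (sym (norm-* (y zero) _))
      (*-mono (norm-nonNeg (y zero)) (h zero) (norm-nonNeg (∏ᵍ (λ l → y (suc l))))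
        (norm-∏-≤ (λ l → y (suc l)) 1≤C (λ l → h (suc l))))

    ^-≤-suc : 1ℚ ≤ p → ∀ k → p ^ k ≤ p ^ suc k
    ^-≤-suc {p} 1≤p k = subst (_≤ p * p ^ k) (ℚₚ.*-identityˡ (p ^ k))
      (*-mono 0≤1 1≤p (^-nonNeg k (≤-trans 0≤1 1≤p)) ≤-refl)

    -- One factor is kept exactly because it may vanish. As `1ℚ ≤ C`, the exponent can stay `k` and
    -- the remaining factors need not be counted.
    norm-∏-≤₁ : ∀ {k} {C} (y : Fin k → ℚ[i]) → 1ℚ ≤ C → (∀ l → norm (y l) ≤ C) →
                ∀ i → norm (∏ᵍ y) ≤ norm (y i) * C ^ k
    norm-∏-≤₁ {suc k} {C} y 1≤C h zero = subst (_≤ norm (y zero) * C ^ suc k) (sym (norm-* (y zero) _))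
      (*-monoˡ (norm-nonNeg (y zero))
        (≤-trans (norm-∏-≤ (λ l → y (suc l)) 1≤C (λ l → h (suc l))) (^-≤-suc 1≤C k)))
    norm-∏-≤₁ {suc k} {C} y 1≤C h (suc i) = subst₂ _≤_ (sym (norm-* (y zero) _))
      (solve 3 (λ a b c → a :* (b :* c) := b :* (a :* c)) refl C (norm (y (suc i))) (C ^ k))
      (*-mono (norm-nonNeg (y zero)) (h zero) (norm-nonNeg (∏ᵍ (λ l → y (suc l))))
        (norm-∏-≤₁ (λ l → y (suc l)) 1≤C (λ l → h (suc l)) i))

    -- The two kept factors sit at different positions, so (x - a) (x - b) is extracted even if the
    -- entries a and b have the same value.
    norm-∏-≤₂ : ∀ {k} {C} (y : Fin k → ℚ[i]) → 1ℚ ≤ C → (∀ l → norm (y l) ≤ C) →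
                ∀ i j → i Fin.< j → norm (∏ᵍ y) ≤ norm (y i) * (norm (y j) * C ^ k)
    norm-∏-≤₂ {suc k} {C} y 1≤C h zero (suc j) _ =
      subst (_≤ norm (y zero) * (norm (y (suc j)) * C ^ suc k)) (sym (norm-* (y zero) _))
        (*-monoˡ (norm-nonNeg (y zero))
          (≤-trans (norm-∏-≤₁ (λ l → y (suc l)) 1≤C (λ l → h (suc l)) j)
            (*-monoˡ (norm-nonNeg (y (suc j))) (^-≤-suc 1≤C k))))
    norm-∏-≤₂ {suc k} {C} y 1≤C h (suc i) (suc j) (s≤s i<j) = subst₂ _≤_ (sym (norm-* (y zero) _))
      (solve 4 (λ a b c d → a :* (b :* (c :* d)) := b :* (c :* (a :* d))) refl
        C (norm (y (suc i))) (norm (y (suc j))) (C ^ k))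
      (*-mono (norm-nonNeg (y zero)) (h zero) (norm-nonNeg (∏ᵍ (λ l → y (suc l))))
        (norm-∏-≤₂ (λ l → y (suc l)) 1≤C (λ l → h (suc l)) i j i<j))

  -- Size of the quotient, and numerical inequalities

  ν : ℕ → ℚ
  ν zero    = 0ℚ
  ν (suc n) = 1ℚ + ν n

  4ℚ : ℚ
  4ℚ = + 4 / 1

  closed-≤ : {_ : True (p ℚₚ.≤? q)} → p ≤ q
  closed-≤ {_} {_} {t} = toWitness t

  closed-< : {_ : True (p ℚₚ.<? q)} → p < q
  closed-< {_} {_} {t} = toWitness t

  abstract
    ν-nonNeg : ∀ n → 0ℚ ≤ ν n
    ν-nonNeg zero    = ≤-refl
    ν-nonNeg (suc n) = +-nonNeg 0≤1 (ν-nonNeg n)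

    ν-≤ : ∀ d n → ν n ≤ ν (d ℕ.+ n)
    ν-≤ zero    n = ≤-refl
    ν-≤ (suc d) n = ≤-trans (ν-≤ d n) (slack 0≤1 (ℚₚ.+-comm 1ℚ (ν (d ℕ.+ n))))

    4≤ν : ∀ m → 4ℚ ≤ ν (4 ℕ.+ m)
    4≤ν m = slack (ν-nonNeg m)
      (solve 1 (λ v → con 1ℚ :+ (con 1ℚ :+ (con 1ℚ :+ (con 1ℚ :+ v))) := con 4ℚ :+ v) refl (ν m))

    1≤^ : ∀ n → 1ℚ ≤ p → 1ℚ ≤ p ^ n
    1≤^ {p} n 1≤p = subst (_≤ p ^ n) (^-one n) (^-mono n 0≤1 1≤p)

    quotient-≼ : ∀ n → z ≼ s → w ≼ s → quotient (suc n) z w ≼ ν (suc n) * s ^ n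
    quotient-≼ {x} {s} {a} zero hx ha = subst (quotient 1 x a ≼_)
      (solve 1 (λ s → con 1ℚ :+ s :* con 0ℚ := (con 1ℚ :+ con 0ℚ) :* con 1ℚ) refl s)
      (≼-+ ≼-1 (≼-* ha (≼-real ≤-refl)))
    quotient-≼ {x} {s} {a} (suc n) hx ha = subst (quotient (suc (suc n)) x a ≼_)
      (solve 3 (λ s p v → s :* p :+ s :* (v :* p) := (con 1ℚ :+ v) :* (s :* p)) refl s (s ^ n) (ν (suc n)))
      (≼-+ (≼-^ (suc n) hx) (≼-* ha (quotient-≼ n hx ha)))

    -- By `quotient-perturb` each step adds `c` times a quotient of size v (1 + h) ^ n, where v =
    -- `ν (suc n)`, and v + v ^ 2 ≤ (1 + v) ^ 2 closes the induction. The full square is about twice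
    -- the sharp constant but makes the remainder visibly nonnegative.
    quotient-perturb-≼ : ∀ n → 0ℚ ≤ h → z ≼ 1ℚ + h → w ≼ 1ℚ + h → z -ᵍ w ≼ c →
      quotient (suc n) z w -ᵍ quotient (suc n) w w ≼ c * (ν (suc n) * ν (suc n) * (1ℚ + h) ^ n)
    quotient-perturb-≼ {h} {x} {a} {c} zero 0≤h hx ha hxa =
      subst (_≼ c * (ν 1 * ν 1 * 1ℚ)) (sym (quotient-perturb 0 x a))
        (≼-mono (≼-+ (≼-* hxa (≼-real ≤-refl)) (≼-* ha (≼-minus (≼-real ≤-refl) (≼-real ≤-refl))))
          (slack (radius-nonNeg hxa)
            (solve 2 (λ c h → c :* ((con 1ℚ :+ con 0ℚ) :* (con 1ℚ :+ con 0ℚ) :* con 1ℚ)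
              := (c :* con 0ℚ :+ (con 1ℚ :+ h) :* (con 0ℚ :+ con 0ℚ)) :+ c) refl c h)))
    quotient-perturb-≼ {h} {x} {a} {c} (suc n) 0≤h hx ha hxa =
      subst (_≼ c * (ν (suc (suc n)) * ν (suc (suc n)) * (1ℚ + h) ^ suc n)) (sym (quotient-perturb (suc n) x a))
        (≼-mono (≼-+ (≼-* hxa (quotient-≼ n hx ha)) (≼-* ha (quotient-perturb-≼ n 0≤h hx ha hxa)))
          (slack (*-nonNeg (radius-nonNeg hxa) (*-nonNeg (^-nonNeg n (+-nonNeg 0≤1 0≤h))
              (+-nonNeg (+-nonNeg 0≤1 0≤v) (+-nonNeg 0≤h (+-nonNeg (*-nonNeg 0≤h 0≤v) (*-nonNeg 0≤h 0≤v))))))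
            (solve 4 (λ c h p v → c :* ((con 1ℚ :+ v) :* (con 1ℚ :+ v) :* ((con 1ℚ :+ h) :* p))
              := (c :* (v :* p) :+ (con 1ℚ :+ h) :* (c :* (v :* v :* p)))
                 :+ c :* (p :* (con 1ℚ :+ v :+ (h :+ (h :* v :+ h :* v))))) refl
              c h ((1ℚ + h) ^ n) (ν (suc n)))))
      where
      0≤v : 0ℚ ≤ ν (suc n)
      0≤v = ν-nonNeg (suc n)

    -- The extra factor `a` avoids the exponent k - 1 in D(a, a) = k a ^ (k - 1).
    quotient-diagonal : ∀ k a → a *ᵍ quotient k a a ≡ real (ν k) *ᵍ a ^ᵍ k
    quotient-diagonal zero    a = S.solve 1 (λ a → a S.:* S.con (real 0ℚ) S.:= S.con (real 0ℚ) S.:* S.con 1ᵍ) refl a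
    quotient-diagonal (suc k) a = trans
      (S.solve 3 (λ a p d → a S.:* (p S.:+ a S.:* d) S.:= a S.:* p S.:+ a S.:* (a S.:* d)) refl a (a ^ᵍ k) (quotient k a a))
      (trans (cong (λ t → a *ᵍ a ^ᵍ k +ᵍ a *ᵍ t) (quotient-diagonal k a))
        (S.solve 3 (λ a p v → a S.:* p S.:+ a S.:* (v S.:* p) S.:= (S.con 1ᵍ S.:+ v) S.:* (a S.:* p)) refl
          a (a ^ᵍ k) (real (ν k))))

    -- The elementary substitute for (1 + h) ^ n ≤ exp (n h).
    ^-upper : ∀ n → 0ℚ ≤ h → (1ℚ + h) ^ n * (1ℚ - ν n * h) ≤ 1ℚ
    ^-upper {h} zero    0≤h = ≤-reflexive (solve 1 (λ h → con 1ℚ :* (con 1ℚ :- con 0ℚ :* h) := con 1ℚ) refl h)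
    ^-upper {h} (suc n) 0≤h = ≤-trans
      (slack (*-nonNeg (^-nonNeg n (+-nonNeg 0≤1 0≤h)) (*-nonNeg (ν-nonNeg (suc n)) (*-nonNeg 0≤h 0≤h)))
        (solve 3 (λ h p v → p :* (con 1ℚ :- v :* h)
          := (con 1ℚ :+ h) :* p :* (con 1ℚ :- (con 1ℚ :+ v) :* h) :+ p :* ((con 1ℚ :+ v) :* (h :* h))) refl
          h ((1ℚ + h) ^ n) (ν n)))
      (^-upper n 0≤h)

    -- For roots near 2: (1.7 ^ 2) ^ k beats k 2.3 ^ (k - 1), with one more power to spare for the
    -- errors. At k = 4 it reads 60.8 against 69.8; each further step multiplies the left side by at
    -- most 6 / 5 · 2.3 = 2.76 and the right side by 2.89.
    growth : ∀ m → (1ℚ + ν (4 ℕ.+ m)) * (+ 23 / 10) ^ (3 ℕ.+ m) ≤ (+ 289 / 100) ^ (4 ℕ.+ m)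
    growth zero    = closed-≤
    growth (suc m) = ≤-trans
      (slack (*-nonNeg (^-nonNeg {+ 23 / 10} (3 ℕ.+ m) (/-nonNeg 23 9))
               (+-nonNeg (*-nonNeg (/-nonNeg 59 99) (ν-nonNeg m)) (/-nonNeg 65 99)))
        (solve 2 (λ v w →
          let κ = con 1ℚ :+ (con 1ℚ :+ (con 1ℚ :+ (con 1ℚ :+ v))) in
          con (+ 289 / 100) :* ((con 1ℚ :+ κ) :* w)
            := (con 1ℚ :+ (con 1ℚ :+ κ)) :* (con (+ 23 / 10) :* w)
               :+ w :* (con (+ 59 / 100) :* v :+ con (+ 65 / 100))) refl
          (ν m) ((+ 23 / 10) ^ (3 ℕ.+ m))))
      (*-monoˡ (/-nonNeg 289 99) (growth m))

    -- With s = |a| ^ 2 - 1 the right side is |a| ^ 8 (2 - |a| ^ 2). The difference of the two sides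
    -- is s times 2.9 + 2 s - 2 s ^ 2 - 3 s ^ 3 - s ^ 4, grouped as 2 s (1 - s), the cubes and the
    -- fourth power compared with their values at 0.9, and the leftover 0.0569.
    quartic : 0ℚ ≤ s → s ≤ + 9 / 10 → 1ℚ + + 1 / 10 * s ≤ (1ℚ + s) ^ 4 * (1ℚ - s)
    quartic {s} 0≤s s≤ = slack
      (*-nonNeg 0≤s (+-nonNeg (+-nonNeg (*-nonNeg 0≤s (+-nonNeg 0≤9/10-s (/-nonNeg 1 9)))
                                        (*-nonNeg 0≤s (+-nonNeg 0≤9/10-s (/-nonNeg 1 9))))
                              (+-nonNeg (+-nonNeg (cube 3) (+-nonNeg (cube 3) (cube 3))) (+-nonNeg (cube 4) (/-nonNeg 569 9999)))))
      (solve 1 (λ s →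
        let s³ = s :* (s :* (s :* con 1ℚ))
            v  = con (+ 9 / 10) :- s :+ con (+ 1 / 10)
            d₃ = con ((+ 9 / 10) ^ 3) :- s³
            t  = con 1ℚ :+ s in
        t :* (t :* (t :* (t :* con 1ℚ))) :* (con 1ℚ :- s)
          := con 1ℚ :+ con (+ 1 / 10) :* s
             :+ s :* (s :* v :+ s :* v
                :+ (d₃ :+ (d₃ :+ d₃) :+ (con ((+ 9 / 10) ^ 4) :- s :* s³ :+ con (+ 569 / 10000))))) refl s)
      where
      0≤9/10-s : 0ℚ ≤ + 9 / 10 - s
      0≤9/10-s = subst (_≤ + 9 / 10 - s) (ℚₚ.+-inverseʳ s) (ℚₚ.+-monoˡ-≤ (- s) s≤)
      cube : ∀ n → 0ℚ ≤ (+ 9 / 10) ^ n - s ^ n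
      cube n = subst (_≤ (+ 9 / 10) ^ n - s ^ n) (ℚₚ.+-inverseʳ (s ^ n)) (ℚₚ.+-monoˡ-≤ (- s ^ n) (^-mono n 0≤s s≤))

  -- Contradiction from a pair within t / 20, where t is at most 1 / k ^ 2

  module _ (m : ℕ) {t : ℚ} (0≤t : 0ℚ ≤ t) (κκt≤1 : ν (4 ℕ.+ m) * ν (4 ℕ.+ m) * t ≤ 1ℚ)
           {a x : ℚ[i]} (x-a : x -ᵍ a ≼ + 1 / 20 * t)
           (hT : obstruction (4 ℕ.+ m) x a ≼ + 1 / 1000 * t)
           (hu : sparse (4 ℕ.+ m) a ≼ + 1 / 1000 * t) where

    private
      k : ℕ
      k = 4 ℕ.+ m

      κ η : ℚ
      κ = ν k
      η = + 1 / 1000 * t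

      A X Q Qₐ u T : ℚ[i]
      A  = a ^ᵍ k
      X  = x ^ᵍ k
      Q  = quotient k x a
      Qₐ = quotient k a a
      u  = sparse k a
      T  = obstruction k x a

    abstract
      private
        0≤κ : 0ℚ ≤ κ
        0≤κ = ν-nonNeg k

        0≤η : 0ℚ ≤ η
        0≤η = *-nonNeg (/-nonNeg 1 999) 0≤t

        κt≤¼ : κ * t ≤ + 1 / 4
        κt≤¼ = begin
          κ * t                          ≡⟨ solve 1 (λ s → s := con (+ 1 / 4) :* (con 4ℚ :* s)) refl (κ * t) ⟩
          + 1 / 4 * (4ℚ * (κ * t))       ≤⟨ *-monoˡ (/-nonNeg 1 3) (*-mono (/-nonNeg 4 0) (4≤ν m) (*-nonNeg 0≤κ 0≤t) ≤-refl) ⟩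
          + 1 / 4 * (κ * (κ * t))        ≡⟨ cong (+ 1 / 4 *_) (sym (ℚₚ.*-assoc κ κ t)) ⟩
          + 1 / 4 * (κ * κ * t)          ≤⟨ *-monoˡ (/-nonNeg 1 3) κκt≤1 ⟩
          + 1 / 4 * 1ℚ                   ∎
          where open ≤-Reasoning

        t≤1/16 : t ≤ + 1 / 16
        t≤1/16 = begin
          t                      ≡⟨ solve 1 (λ s → s := con (+ 1 / 4) :* (con 4ℚ :* s)) refl t ⟩
          + 1 / 4 * (4ℚ * t)     ≤⟨ *-monoˡ (/-nonNeg 1 3) (*-mono (/-nonNeg 4 0) (4≤ν m) 0≤t ≤-refl) ⟩
          + 1 / 4 * (κ * t)      ≤⟨ *-monoˡ (/-nonNeg 1 3) κt≤¼ ⟩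
          + 1 / 4 * (+ 1 / 4)    ∎
          where open ≤-Reasoning

        η≤ : η ≤ + 1 / 16000
        η≤ = *-monoˡ (/-nonNeg 1 999) t≤1/16

        1-u : A *ᵍ (2ᵍ -ᵍ a) ≡ 1ᵍ -ᵍ u
        1-u = S.solve 2 (λ p a → p S.:* (S.con 1ᵍ S.:+ S.con 1ᵍ S.:- a)
          S.:= S.con 1ᵍ S.:- (S.con 1ᵍ S.:- p S.:* (S.con 1ᵍ S.:+ S.con 1ᵍ S.:- a))) refl A a

        -- Perturbed form of |a| ^ k |2 - a| = 1. It rules out the middle range of |a| and forces
        -- `a` close to 2 beyond it.
        norm-1-u : norm a ^ k * norm (2ᵍ -ᵍ a) ≤ (1ℚ + η) * (1ℚ + η)
        norm-1-u = subst (_≤ (1ℚ + η) * (1ℚ + η))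
          (trans (cong norm (sym 1-u)) (trans (norm-* A (2ᵍ -ᵍ a)) (cong (_* norm (2ᵍ -ᵍ a)) (norm-^ a k))))
          (norm-≤ (≼-minus ≼-1 hu))

        -- Perturbed form of (a b) ^ k = D(a, b).
        AX : A *ᵍ X ≡ T +ᵍ (1ᵍ -ᵍ u) *ᵍ Q
        AX = trans
          (S.solve 4 (λ p q a d → q S.:* p S.:= q S.:* (p S.:- (S.con 1ᵍ S.:+ S.con 1ᵍ S.:- a) S.:* d)
            S.:+ q S.:* (S.con 1ᵍ S.:+ S.con 1ᵍ S.:- a) S.:* d) refl X A a Q)
          (cong (λ z → T +ᵍ z *ᵍ Q) 1-u)

        -- By `quotient-diagonal` and `1-u`, a (2 - a) Qₐ = κ (1 - u). Then Qₐ = Q - (Q - Qₐ), and Q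
        -- = u Q + (A X - T) by `AX`, so that only A X is not an error term.
        κ-decomposition : real κ ≡ real κ *ᵍ u +ᵍ
          a *ᵍ (2ᵍ -ᵍ a) *ᵍ ((-ᵍ (Q -ᵍ Qₐ)) +ᵍ (u *ᵍ Q +ᵍ (A *ᵍ X -ᵍ T)))
        κ-decomposition = sym (begin
          real κ *ᵍ u +ᵍ a *ᵍ (2ᵍ -ᵍ a) *ᵍ ((-ᵍ (Q -ᵍ Qₐ)) +ᵍ (u *ᵍ Q +ᵍ (A *ᵍ X -ᵍ T)))
            ≡⟨ cong (λ z → real κ *ᵍ u +ᵍ a *ᵍ (2ᵍ -ᵍ a) *ᵍ ((-ᵍ (Q -ᵍ Qₐ)) +ᵍ (u *ᵍ Q +ᵍ (z -ᵍ T)))) AX ⟩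
          real κ *ᵍ u +ᵍ a *ᵍ (2ᵍ -ᵍ a) *ᵍ ((-ᵍ (Q -ᵍ Qₐ)) +ᵍ (u *ᵍ Q +ᵍ (T +ᵍ (1ᵍ -ᵍ u) *ᵍ Q -ᵍ T)))
            ≡⟨ S.solve 6 (λ κ u a d e T → let b = S.con 1ᵍ S.:+ S.con 1ᵍ S.:- a in
                 κ S.:* u S.:+ a S.:* b S.:* ((S.:- (d S.:- e)) S.:+ (u S.:* d S.:+ (T S.:+ (S.con 1ᵍ S.:- u) S.:* d S.:- T)))
                 S.:= κ S.:* u S.:+ b S.:* (a S.:* e)) refl (real κ) u a Q Qₐ T ⟩
          real κ *ᵍ u +ᵍ (2ᵍ -ᵍ a) *ᵍ (a *ᵍ Qₐ)
            ≡⟨ cong (λ z → real κ *ᵍ u +ᵍ (2ᵍ -ᵍ a) *ᵍ z) (quotient-diagonal k a) ⟩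
          real κ *ᵍ u +ᵍ (2ᵍ -ᵍ a) *ᵍ (real κ *ᵍ A)
            ≡⟨ S.solve 4 (λ κ u b p → κ S.:* u S.:+ b S.:* (κ S.:* p) S.:= κ S.:* (u S.:+ p S.:* b)) refl
                 (real κ) u (2ᵍ -ᵍ a) A ⟩
          real κ *ᵍ (u +ᵍ A *ᵍ (2ᵍ -ᵍ a))
            ≡⟨ cong (λ z → real κ *ᵍ (u +ᵍ z)) 1-u ⟩
          real κ *ᵍ (u +ᵍ (1ᵍ -ᵍ u))
            ≡⟨ S.solve 2 (λ κ u → κ S.:* (u S.:+ (S.con 1ᵍ S.:- u)) S.:= κ) refl (real κ) u ⟩
          real κ ∎)
          where open ≡-Reasoning

        -- Every term of `κ-decomposition` is small except a (2 - a) A X, whose modulus is close to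
        -- 3 at most. The total stays below 3.9, while `κ` is at least 4.
        inside : norm a ≤ 1ℚ + + 3 / 100 * t → ⊥
        inside na = <⇒≱ (closed-< {p = + 39 / 10} {q = 4ℚ}) (≤-trans (4≤ν m) (≤-trans
            (real-≼⇒≤ (subst (_≼ bound) (sym κ-decomposition)
              (≼-+ (≼-* (≼-real 0≤κ) hu)
                (≼-* (≼-* ha (≼-minus (≼-real {1ℚ + 1ℚ} (/-nonNeg 2 0)) ha))
                  (≼-+ (≼-neg (quotient-perturb-≼ (3 ℕ.+ m) 0≤χ hx ha x-a))
                    (≼-+ (≼-* hu (quotient-≼ (3 ℕ.+ m) hx ha))
                      (≼-minus (≼-* (≼-^ k ha) (≼-^ k hx)) hT)))))))
            numeric))
          where
          open ≤-Reasoning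
          χ ρ P bound : ℚ
          -- 3 / 100 for the radius of `a`, plus 1 / 20 for the distance from `a` to `x`.
          χ = + 2 / 25 * t
          ρ = 1ℚ + χ
          P = ρ ^ (3 ℕ.+ m)
          bound = κ * η + ρ * ((1ℚ + 1ℚ) + ρ) *
            (+ 1 / 20 * t * (κ * κ * P) + (η * (κ * P) + (ρ * P * (ρ * P) + η)))
          0≤χ : 0ℚ ≤ χ
          0≤χ = *-nonNeg (/-nonNeg 2 24) 0≤t
          0≤ρ : 0ℚ ≤ ρ
          0≤ρ = +-nonNeg 0≤1 0≤χ
          0≤P : 0ℚ ≤ P
          0≤P = ^-nonNeg (3 ℕ.+ m) 0≤ρ
          ha₁ : a ≼ 1ℚ + + 3 / 100 * t
          ha₁ = mk≼ 0≤r (≤-trans na (slack (*-nonNeg 0≤t' 0≤r)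
            (solve 1 (λ r → (con 1ℚ :+ r) :* (con 1ℚ :+ r) := con 1ℚ :+ r :+ r :* (con 1ℚ :+ r)) refl (+ 3 / 100 * t))))
            where
            0≤t' : 0ℚ ≤ + 3 / 100 * t
            0≤t' = *-nonNeg (/-nonNeg 3 99) 0≤t
            0≤r : 0ℚ ≤ 1ℚ + + 3 / 100 * t
            0≤r = +-nonNeg 0≤1 0≤t'
          ha : a ≼ ρ
          ha = ≼-mono ha₁ (slack (*-nonNeg (/-nonNeg 1 19) 0≤t)
            (solve 1 (λ t → con 1ℚ :+ con (+ 2 / 25) :* t := con 1ℚ :+ con (+ 3 / 100) :* t :+ con (+ 1 / 20) :* t) refl t))
          hx : x ≼ ρ
          hx = subst (x ≼_)
            (solve 1 (λ t → con (+ 1 / 20) :* t :+ (con 1ℚ :+ con (+ 3 / 100) :* t) := con 1ℚ :+ con (+ 2 / 25) :* t) refl t)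
            (≼-shift x-a ha₁)
          ρ≤ : ρ ≤ + 101 / 100
          ρ≤ = begin
            1ℚ + + 2 / 25 * t          ≤⟨ ℚₚ.+-monoʳ-≤ 1ℚ (*-monoˡ (/-nonNeg 2 24) t≤1/16) ⟩
            1ℚ + + 2 / 25 * (+ 1 / 16) ≤⟨ closed-≤ ⟩
            + 101 / 100                ∎
          νχ≤ : ν (3 ℕ.+ m) * χ ≤ + 1 / 50
          νχ≤ = begin
            ν (3 ℕ.+ m) * (+ 2 / 25 * t) ≤⟨ *-mono (ν-nonNeg (3 ℕ.+ m)) (ν-≤ 1 (3 ℕ.+ m)) 0≤χ ≤-refl ⟩
            κ * (+ 2 / 25 * t)
              ≡⟨ solve 2 (λ κ t → κ :* (con (+ 2 / 25) :* t) := con (+ 2 / 25) :* (κ :* t)) refl κ t ⟩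
            + 2 / 25 * (κ * t)           ≤⟨ *-monoˡ (/-nonNeg 2 24) κt≤¼ ⟩
            + 2 / 25 * (+ 1 / 4)         ≡⟨ refl ⟩
            + 1 / 50                     ∎
          P≤ : P ≤ + 103 / 100
          P≤ = begin
            -- Since (k - 1) χ ≤ 1 / 50, `^-upper` yields P · 49 / 50 ≤ 1.
            P                            ≡⟨ solve 1 (λ P → P := con (+ 50 / 49) :* (P :* con (+ 49 / 50))) refl P ⟩
            + 50 / 49 * (P * (+ 49 / 50))
              ≤⟨ *-monoˡ (/-nonNeg 50 48) (*-monoˡ 0≤P (ℚₚ.+-monoʳ-≤ 1ℚ (ℚₚ.neg-antimono-≤ νχ≤))) ⟩
            + 50 / 49 * (P * (1ℚ - ν (3 ℕ.+ m) * χ)) ≤⟨ *-monoˡ (/-nonNeg 50 48) (^-upper (3 ℕ.+ m) 0≤χ) ⟩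
            + 50 / 49 * 1ℚ               ≤⟨ closed-≤ ⟩
            + 103 / 100                  ∎
          κη≤ : κ * η ≤ + 1 / 4000
          κη≤ = begin
            κ * (+ 1 / 1000 * t)
              ≡⟨ solve 2 (λ κ t → κ :* (con (+ 1 / 1000) :* t) := con (+ 1 / 1000) :* (κ :* t)) refl κ t ⟩
            + 1 / 1000 * (κ * t)           ≤⟨ *-monoˡ (/-nonNeg 1 999) κt≤¼ ⟩
            + 1 / 1000 * (+ 1 / 4)         ≡⟨ refl ⟩
            + 1 / 4000                     ∎
          ρP≤ : ρ * P ≤ + 101 / 100 * (+ 103 / 100)
          ρP≤ = *-mono 0≤ρ ρ≤ 0≤P P≤
          perturb≤ : + 1 / 20 * t * (κ * κ * P) ≤ + 1 / 20 * (1ℚ * (+ 103 / 100))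
          perturb≤ = begin
            + 1 / 20 * t * (κ * κ * P)
              ≡⟨ solve 3 (λ t κ P → con (+ 1 / 20) :* t :* (κ :* κ :* P) := con (+ 1 / 20) :* (κ :* κ :* t :* P)) refl t κ P ⟩
            + 1 / 20 * (κ * κ * t * P)
              ≤⟨ *-monoˡ (/-nonNeg 1 19) (*-mono (*-nonNeg (*-nonNeg 0≤κ 0≤κ) 0≤t) κκt≤1 0≤P P≤) ⟩
            + 1 / 20 * (1ℚ * (+ 103 / 100)) ∎
          ηκP≤ : η * (κ * P) ≤ + 1 / 4000 * (+ 103 / 100)
          ηκP≤ = subst (_≤ + 1 / 4000 * (+ 103 / 100))
            (solve 3 (λ η κ P → κ :* η :* P := η :* (κ :* P)) refl η κ P)
            (*-mono (*-nonNeg 0≤κ 0≤η) κη≤ 0≤P P≤)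
          numeric : bound ≤ + 39 / 10
          numeric = begin
            bound
              ≤⟨ ℚₚ.+-mono-≤ κη≤
                   (*-mono (*-nonNeg 0≤ρ (+-nonNeg {1ℚ + 1ℚ} {ρ} (/-nonNeg 2 0) 0≤ρ))
                     (*-mono 0≤ρ ρ≤ (+-nonNeg {1ℚ + 1ℚ} {ρ} (/-nonNeg 2 0) 0≤ρ) (ℚₚ.+-monoʳ-≤ (1ℚ + 1ℚ) ρ≤))
                     (+-nonNeg (*-nonNeg (*-nonNeg (/-nonNeg 1 19) 0≤t) (*-nonNeg (*-nonNeg 0≤κ 0≤κ) 0≤P))
                       (+-nonNeg (*-nonNeg 0≤η (*-nonNeg 0≤κ 0≤P))
                         (+-nonNeg (*-nonNeg (*-nonNeg 0≤ρ 0≤P) (*-nonNeg 0≤ρ 0≤P)) 0≤η)))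
                     (ℚₚ.+-mono-≤ perturb≤ (ℚₚ.+-mono-≤ ηκP≤
                       (ℚₚ.+-mono-≤ (square-mono (*-nonNeg 0≤ρ 0≤P) ρP≤) η≤)))) ⟩
            + 1 / 4000 + + 101 / 100 * ((1ℚ + 1ℚ) + + 101 / 100) *
              (+ 1 / 20 * (1ℚ * (+ 103 / 100)) + (+ 1 / 4000 * (+ 103 / 100) +
                (+ 101 / 100 * (+ 103 / 100) * (+ 101 / 100 * (+ 103 / 100)) + + 1 / 16000)))
              ≤⟨ closed-≤ ⟩
            + 39 / 10 ∎

        -- The right side exceeds the left by 2 |1 - a| ^ 2.
        norm-2-a : 1ℚ - (norm a - 1ℚ) ≤ norm (2ᵍ -ᵍ a)
        norm-2-a = lower a
          where
          lower : ∀ z → 1ℚ - (norm z - 1ℚ) ≤ norm (2ᵍ -ᵍ z)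
          lower (gauss p q) = slack
            (+-nonNeg (+-nonNeg (square-nonNeg (1ℚ - p)) (square-nonNeg (1ℚ - p)))
                      (+-nonNeg (square-nonNeg q) (square-nonNeg q)))
            (solve 2 (λ p q →
              let z = con 1ℚ :+ con 1ℚ :- p
                  w = con 0ℚ :+ con 0ℚ :- q
                  v = con 1ℚ :- p in
              z :* z :+ w :* w := con 1ℚ :- (p :* p :+ q :* q :- con 1ℚ) :+ (v :* v :+ v :* v :+ (q :* q :+ q :* q)))
              refl p q)

        ^4≤^k : ∀ {p} → 1ℚ ≤ p → p ^ 4 ≤ p ^ k
        ^4≤^k {p} 1≤p = *-monoˡ 0≤p (*-monoˡ 0≤p (*-monoˡ 0≤p (*-monoˡ 0≤p (1≤^ m 1≤p))))
          where
          0≤p : 0ℚ ≤ p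
          0≤p = ≤-trans 0≤1 1≤p

        -- With v = |a| ^ 2 - 1, the product |a| ^ (2 k) |2 - a| ^ 2 is at least (1 + v) ^ 4 (1 -
        -- v), hence at least 1 + v / 10, more than `norm-1-u` permits.
        between : 1ℚ + + 3 / 100 * t < norm a → norm a ≤ + 19 / 10 → ⊥
        between lo hi = <⇒≱ big (begin
          1ℚ + + 1 / 10 * v              ≤⟨ quartic 0≤v v≤ ⟩
          (1ℚ + v) ^ 4 * (1ℚ - v)        ≡⟨ cong (λ z → z ^ 4 * (1ℚ - v)) 1+v ⟩
          norm a ^ 4 * (1ℚ - v)
            ≤⟨ *-mono (^-nonNeg 4 (norm-nonNeg a)) (^4≤^k 1≤N) 0≤1-v norm-2-a ⟩
          norm a ^ k * norm (2ᵍ -ᵍ a)    ≤⟨ norm-1-u ⟩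
          (1ℚ + η) * (1ℚ + η)            ∎)
          where
          open ≤-Reasoning
          v : ℚ
          v = norm a - 1ℚ
          1+v : 1ℚ + v ≡ norm a
          1+v = solve 1 (λ n → con 1ℚ :+ (n :- con 1ℚ) := n) refl (norm a)
          τ<v : + 3 / 100 * t < v
          τ<v = subst (_< v) (solve 1 (λ r → con 1ℚ :+ r :- con 1ℚ := r) refl (+ 3 / 100 * t))
            (ℚₚ.+-monoˡ-< (- 1ℚ) lo)
          0≤v : 0ℚ ≤ v
          0≤v = ≤-trans (*-nonNeg (/-nonNeg 3 99) 0≤t) (<⇒≤ τ<v)
          1≤N : 1ℚ ≤ norm a
          1≤N = slack 0≤v (sym 1+v)
          v≤ : v ≤ + 9 / 10
          v≤ = ℚₚ.+-monoˡ-≤ (- 1ℚ) hi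
          0≤1-v : 0ℚ ≤ 1ℚ - v
          0≤1-v = ≤-trans (/-nonNeg 1 9) (ℚₚ.+-monoʳ-≤ 1ℚ (ℚₚ.neg-antimono-≤ v≤))
          big : (1ℚ + η) * (1ℚ + η) < 1ℚ + + 1 / 10 * v
          big = begin-strict
            (1ℚ + η) * (1ℚ + η)
              -- The threshold 3 t / 100 makes v / 10 exceed 3 η, which covers 2 η + η ^ 2.
              ≤⟨ slack (*-nonNeg 0≤η (+-nonNeg {1ℚ - η} (≤-trans (closed-≤ {p = 0ℚ} {q = 1ℚ - + 1 / 16000})
                   (ℚₚ.+-monoʳ-≤ 1ℚ (ℚₚ.neg-antimono-≤ η≤))) ≤-refl))
                 (solve 1 (λ t → let η = con (+ 1 / 1000) :* t in
                   con 1ℚ :+ con (+ 1 / 10) :* (con (+ 3 / 100) :* t)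
                     := (con 1ℚ :+ η) :* (con 1ℚ :+ η) :+ η :* ((con 1ℚ :- η) :+ con 0ℚ)) refl t) ⟩
            1ℚ + + 1 / 10 * (+ 3 / 100 * t)   <⟨ ℚₚ.+-monoʳ-< 1ℚ (*-monoˡ-< (/-pos 0 9) τ<v) ⟩
            1ℚ + + 1 / 10 * v                 ∎

        -- Applied to `a`, within 0.28 of 2, and to `x`, at most 1 / 320 further away. The value
        -- 2.89 is 1.7 ^ 2.
        near-2 : ∀ {z} → 2ᵍ -ᵍ z ≼ + 29 / 100 → z ≼ + 23 / 10 × + 289 / 100 ≤ norm z
        near-2 {z} h =
          ≼-mono (subst (_≼ + 229 / 100) (S.solve 1 (λ z → two S.:- (two S.:- z) S.:= z) refl z)
            (≼-minus (≼-real {1ℚ + 1ℚ} (/-nonNeg 2 0)) h)) closed-≤ ,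
          ℚₚ.≮⇒≥ λ small → <⇒≱ (closed-< {p = + 199 / 100} {q = 1ℚ + 1ℚ})
            (real-≼⇒≤ (subst (_≼ + 199 / 100) (S.solve 1 (λ z → two S.:- z S.:+ z S.:= two) refl z)
              (≼-+ h (norm-<⇒≼ {+ 17 / 10} {z} (/-nonNeg 17 9) small))))
          where
          two : ∀ {n} → S.Polynomial n
          two = S.con 1ᵍ S.:+ S.con 1ᵍ

        outside : + 19 / 10 < norm a → ⊥
        outside lo = <⇒≱ big (begin
          (+ 289 / 100) ^ k              ≤⟨ ≼⇒≤ norm-AX (subst (_≼ bound) (sym AX)
                                              (≼-+ hT (≼-* (≼-minus ≼-1 hu) (quotient-≼ (3 ℕ.+ m) (proj₁ hx) (proj₁ ha))))) ⟩
          bound                          ∎)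
          where
          open ≤-Reasoning
          W bound : ℚ
          W = (+ 23 / 10) ^ (3 ℕ.+ m)
          bound = η + (1ℚ + η) * (κ * W)
          2-a : 2ᵍ -ᵍ a ≼ + 28 / 100
          2-a = mk≼ (/-nonNeg 28 99) (ℚₚ.≮⇒≥ λ large →
            <⇒≱ (begin-strict
              (1ℚ + η) * (1ℚ + η)
                ≤⟨ square-mono (+-nonNeg 0≤1 0≤η) (ℚₚ.+-monoʳ-≤ 1ℚ η≤) ⟩
              (1ℚ + + 1 / 16000) * (1ℚ + + 1 / 16000)
                <⟨ closed-< ⟩
              (+ 19 / 10) ^ 4 * (+ 28 / 100 * (+ 28 / 100))
                <⟨ *-monoˡ-< (^-pos 4 (/-pos 18 9)) large ⟩
              (+ 19 / 10) ^ 4 * norm (2ᵍ -ᵍ a) ∎)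
            (≤-trans (*-mono (^-nonNeg {+ 19 / 10} 4 (/-nonNeg 19 9))
                (≤-trans (^-mono 4 (/-nonNeg 19 9) (<⇒≤ lo)) (^4≤^k (≤-trans (closed-≤ {p = 1ℚ} {q = + 19 / 10}) (<⇒≤ lo))))
                (norm-nonNeg (2ᵍ -ᵍ a)) ≤-refl)
              norm-1-u))
          ha : a ≼ + 23 / 10 × + 289 / 100 ≤ norm a
          ha = near-2 (≼-mono 2-a closed-≤)
          hx : x ≼ + 23 / 10 × + 289 / 100 ≤ norm x
          hx = near-2 (≼-mono (≼-triangle {2ᵍ} {a} {u = x} 2-a (≼-swap {x} {a} x-a))
            (≤-trans (ℚₚ.+-monoʳ-≤ (+ 28 / 100) (*-monoˡ (/-nonNeg 1 19) t≤1/16)) closed-≤))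
          norm-AX : (+ 289 / 100) ^ k * (+ 289 / 100) ^ k ≤ norm (A *ᵍ X)
          norm-AX = subst ((+ 289 / 100) ^ k * (+ 289 / 100) ^ k ≤_)
            (sym (trans (norm-* A X) (cong₂ _*_ (norm-^ a k) (norm-^ x k))))
            (*-mono (^-nonNeg k (/-nonNeg 289 99)) (^-mono k (/-nonNeg 289 99) (proj₂ ha))
                    (^-nonNeg k (/-nonNeg 289 99)) (^-mono k (/-nonNeg 289 99) (proj₂ hx)))
          κη≤ : κ * η ≤ + 1 / 4000
          κη≤ = subst (_≤ + 1 / 4000)
            (solve 2 (λ κ t → con (+ 1 / 1000) :* (κ :* t) := κ :* (con (+ 1 / 1000) :* t)) refl κ t)
            (*-monoˡ (/-nonNeg 1 999) κt≤¼)
          big : bound < (+ 289 / 100) ^ k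
          big = begin-strict
            η + (1ℚ + η) * (κ * W)
              ≡⟨ solve 3 (λ η κ W → η :+ (con 1ℚ :+ η) :* (κ :* W) := η :+ κ :* η :* W :+ κ :* W) refl η κ W ⟩
            η + κ * η * W + κ * W
              ≤⟨ ℚₚ.+-monoˡ-≤ (κ * W) (ℚₚ.+-mono-≤ (≤-trans η≤ (subst (_≤ + 1 / 16000 * W) refl
                   (*-monoˡ {+ 1 / 16000} (/-nonNeg 1 15999) 1≤W)))
                   (*-mono (*-nonNeg 0≤κ 0≤η) κη≤ (≤-trans 0≤1 1≤W) ≤-refl)) ⟩
            + 1 / 16000 * W + + 1 / 4000 * W + κ * W
              ≡⟨ solve 2 (λ κ W → con (+ 1 / 16000) :* W :+ con (+ 1 / 4000) :* W :+ κ :* W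
                   := W :* con (+ 1 / 16000 + + 1 / 4000) :+ κ :* W) refl κ W ⟩
            W * (+ 1 / 16000 + + 1 / 4000) + κ * W
              <⟨ ℚₚ.+-monoˡ-< (κ * W) (*-monoˡ-< (<-≤-trans 0<1 1≤W)
                   (closed-< {p = + 1 / 16000 + + 1 / 4000} {q = 1ℚ})) ⟩
            W * 1ℚ + κ * W
              ≡⟨ solve 2 (λ κ W → W :* con 1ℚ :+ κ :* W := (con 1ℚ :+ κ) :* W) refl κ W ⟩
            (1ℚ + κ) * W                ≤⟨ growth m ⟩
            (+ 289 / 100) ^ k           ∎
            where
            1≤W : 1ℚ ≤ W
            1≤W = 1≤^ {+ 23 / 10} (3 ℕ.+ m) closed-≤

      no-close-pair : ⊥
      no-close-pair with norm a ℚₚ.≤? 1ℚ + + 3 / 100 * t | norm a ℚₚ.≤? + 19 / 10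
      ... | yes near | _        = inside near
      ... | no  far  | yes near = between (ℚₚ.≰⇒> far) near
      ... | no  _    | no  far  = outside (ℚₚ.≰⇒> far)

  at : ℕ → ℂ → ℚ[i]
  at n z = gauss (seq (re z) n) (seq (im z) n)

  abstract
    at-^ : ∀ n z m → at n (z ^ℂ m) ≡ at n z ^ᵍ m
    at-^ n z zero    = refl
    at-^ n z (suc m) = cong (at n z *ᵍ_) (at-^ n z m)

    at-∑ : ∀ n {k} (f : Fin k → ℂ) → at n (∑ℂ f) ≡ ∑ᵍ (λ i → at n (f i))
    at-∑ n {zero}  f = refl
    at-∑ n {suc k} f = cong (at n (f zero) +ᵍ_) (at-∑ n (λ i → f (suc i)))

    at-∏ : ∀ n {k} (f : Fin k → ℂ) → at n (∏ℂ f) ≡ ∏ᵍ (λ i → at n (f i))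
    at-∏ n {zero}  f = refl
    at-∏ n {suc k} f = cong (at n (f zero) *ᵍ_) (at-∏ n (λ i → f (suc i)))

    ∑ᵍ-cong : ∀ {k} {f g : Fin k → ℚ[i]} → (∀ i → f i ≡ g i) → ∑ᵍ f ≡ ∑ᵍ g
    ∑ᵍ-cong {zero}  h = refl
    ∑ᵍ-cong {suc k} h = cong₂ _+ᵍ_ (h zero) (∑ᵍ-cong (λ i → h (suc i)))

    at-fib : ∀ n k z → at n (fibPoly k z) ≡ fibᵍ k (at n z)
    at-fib n k z = cong₂ _-ᵍ_ (at-^ n z k)
      (trans (at-∑ n {k} (λ i → z ^ℂ toℕ i)) (∑ᵍ-cong {k} (λ i → at-^ n z (toℕ i))))

    abs-square : ∣ p ∣ ≤ q → p * p ≤ q * q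
    abs-square {p} {q} h = subst (_≤ q * q)
      (trans (sym (ℚₚ.∣p*q∣≡∣p∣*∣q∣ p p)) (ℚₚ.0≤p⇒∣p∣≡p (square-nonNeg p)))
      (square-mono (ℚₚ.0≤∣p∣ p) h)

    gauss-≼ : ∣ p ∣ ≤ r → ∣ q ∣ ≤ s → gauss p q ≼ r + s
    gauss-≼ {p} {r} {q} {s} hp hq = mk≼ (+-nonNeg 0≤r 0≤s)
      (≤-trans (ℚₚ.+-mono-≤ (abs-square hp) (abs-square hq))
        (slack (+-nonNeg (*-nonNeg 0≤r 0≤s) (*-nonNeg 0≤r 0≤s))
          (solve 2 (λ r s → (r :+ s) :* (r :+ s) := r :* r :+ s :* s :+ (r :* s :+ r :* s)) refl r s)))
      where
      0≤r : 0ℚ ≤ r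
      0≤r = ≤-trans (ℚₚ.0≤∣p∣ p) hp
      0≤s : 0ℚ ≤ s
      0≤s = ≤-trans (ℚₚ.0≤∣p∣ q) hq

    ≈ℂ⇒≼ : ∀ {z w} → z ≈ℂ w → 0ℚ < ε → ∃ λ N → ∀ n → N ℕ.≤ n → at n z -ᵍ at n w ≼ ε
    ≈ℂ⇒≼ {ε} {z} {w} z≈w 0<ε =
      let M , hr = _≈ℝ_.close (_≈ℂ_.re-≈ z≈w) (½ * ε) (0<½* 0<ε)
          N , hi = _≈ℝ_.close (_≈ℂ_.im-≈ z≈w) (½ * ε) (0<½* 0<ε)
      in M ℕ.⊔ N , λ n n≥ → subst (at n z -ᵍ at n w ≼_) (halves ε)
        (gauss-≼ (<⇒≤ (hr n (ℕₚ.m⊔n≤o⇒m≤o M N n≥))) (<⇒≤ (hi n (ℕₚ.m⊔n≤o⇒n≤o M N n≥))))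

    uniformly-bounded : ∀ {k} (α : Fin k → ℂ) →
      ∃ λ B → 0ℚ ≤ B × ∃ λ N → ∀ n → N ℕ.≤ n → ∀ l → at n (α l) ≼ B
    uniformly-bounded {zero}  α = 0ℚ , ≤-refl , 0 , λ _ _ ()
    uniformly-bounded {suc k} α =
      let B , 0≤B , L , h  = uniformly-bounded (λ l → α (suc l))
          C , 0<C , M , hr = eventually-bounded (seq (re (α zero))) (cauchy (re (α zero)))
          D , 0<D , N , hi = eventually-bounded (seq (im (α zero))) (cauchy (im (α zero)))
      in B + (C + D) , +-nonNeg 0≤B (+-nonNeg (<⇒≤ 0<C) (<⇒≤ 0<D)) , L ℕ.⊔ (M ℕ.⊔ N) , λ n n≥ → λ
        { zero    → ≼-mono
            (gauss-≼ (hr n (ℕₚ.m⊔n≤o⇒m≤o M N (ℕₚ.m⊔n≤o⇒n≤o L (M ℕ.⊔ N) n≥)))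
                     (hi n (ℕₚ.m⊔n≤o⇒n≤o M N (ℕₚ.m⊔n≤o⇒n≤o L (M ℕ.⊔ N) n≥))))
            (slack 0≤B (ℚₚ.+-comm B (C + D)))
        ; (suc l) → ≼-mono (h n (ℕₚ.m⊔n≤o⇒m≤o L (M ℕ.⊔ N) n≥) l)
            (slack {C + D} {B + (C + D)} {B} (+-nonNeg (<⇒≤ 0<C) (<⇒≤ 0<D)) refl)
        }

    -- x lies near b but at distance at least δ from a, so that the factor x - a of
    -- the obstruction can be cancelled whether or not a and b are apart.
    obstruction-small : ∀ k {K δ} {a b x Π : ℚ[i]} → 1ℚ ≤ K → 0ℚ < δ →
      norm (a ^ᵍ k) ≤ K → norm (x -ᵍ 1ᵍ) ≤ K → norm (a -ᵍ 1ᵍ) ≤ K →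
      norm (x -ᵍ b) ≤ δ * δ → δ * δ ≤ norm (x -ᵍ a) →
      fibᵍ k a ≼ δ * δ → fibᵍ k x -ᵍ Π ≼ δ * δ →
      norm Π ≤ norm (x -ᵍ a) * (norm (x -ᵍ b) * K) →
      obstruction k x a ≼ + 4 / 1 * (K * K) * δ
    obstruction-small k {K} {δ} {a} {b} {x} {Π} 1≤K 0<δ hA hx ha hxb hV hfa hfx hΠ =
      mk≼ (*-nonNeg (*-nonNeg (/-nonNeg 4 0) (*-nonNeg 0≤K 0≤K)) (<⇒≤ 0<δ))
        (ℚₚ.≮⇒≥ λ large → <⇒≱ (*-monoˡ-< 0<V large) (begin
          V * norm T
            ≡⟨ trans (ℚₚ.*-comm V (norm T)) (sym (norm-* T (x -ᵍ a))) ⟩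
          norm (T *ᵍ (x -ᵍ a))
            ≡⟨ cong norm split ⟩
          norm (A *ᵍ ((x -ᵍ 1ᵍ) *ᵍ F +ᵍ (-ᵍ u)) +ᵍ A *ᵍ ((x -ᵍ 1ᵍ) *ᵍ Π))
            ≤⟨ norm-+ (A *ᵍ ((x -ᵍ 1ᵍ) *ᵍ F +ᵍ (-ᵍ u))) (A *ᵍ ((x -ᵍ 1ᵍ) *ᵍ Π)) ⟩
          norm (A *ᵍ ((x -ᵍ 1ᵍ) *ᵍ F +ᵍ (-ᵍ u))) + norm (A *ᵍ ((x -ᵍ 1ᵍ) *ᵍ F +ᵍ (-ᵍ u)))
            + (norm (A *ᵍ ((x -ᵍ 1ᵍ) *ᵍ Π)) + norm (A *ᵍ ((x -ᵍ 1ᵍ) *ᵍ Π)))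
            ≤⟨ ℚₚ.+-mono-≤ (ℚₚ.+-mono-≤ first first) (ℚₚ.+-mono-≤ second second) ⟩
          R + R + (K * (K * (V * (E * K))) + K * (K * (V * (E * K))))
            ≤⟨ slack (+-nonNeg
                 (*-nonNeg (*-nonNeg (/-nonNeg 8 0) (*-nonNeg (*-nonNeg 0≤K 0≤K) 0≤E))
                   (+-nonNeg 0≤v (*-nonNeg (+-nonNeg (+-nonNeg 0≤d 0≤d) (*-nonNeg 0≤d 0≤d)) (<⇒≤ 0<V))))
                 (*-nonNeg (*-nonNeg (/-nonNeg 2 0) (*-nonNeg (*-nonNeg (*-nonNeg 0≤K 0≤K) 0≤K) (*-nonNeg (<⇒≤ 0<V) 0≤E)))
                   (+-nonNeg (/-nonNeg 3 0) (*-nonNeg (/-nonNeg 4 0) 0≤d))))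
               (solve 3 (λ K y V →
                 let E = y :* y
                     d = K :- con 1ℚ
                     s = con (+ 4 / 1) :* (K :* K) :* y
                     R = K :* (K :* (E :* E) :+ K :* (E :* E) :+ (K :* (E :* E) :+ K :* (E :* E)))
                     P = K :* (K :* (V :* (E :* K))) in
                 V :* (s :* s) := R :+ R :+ (P :+ P)
                   :+ (con (+ 8 / 1) :* (K :* K :* E) :* ((V :- E) :+ (d :+ d :+ d :* d) :* V)
                      :+ con (+ 2 / 1) :* (K :* K :* K :* (V :* E)) :* (con (+ 3 / 1) :+ con (+ 4 / 1) :* d)))
                 refl K δ V) ⟩
          V * (+ 4 / 1 * (K * K) * δ * (+ 4 / 1 * (K * K) * δ)) ∎))
      where
      open ≤-Reasoning
      A F T u : ℚ[i]
      A = a ^ᵍ k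
      F = fibᵍ k x -ᵍ Π
      T = obstruction k x a
      u = sparse k a
      E V R d : ℚ
      E = δ * δ
      V = norm (x -ᵍ a)
      R = K * (K * (E * E) + K * (E * E) + (K * (E * E) + K * (E * E)))
      d = K - 1ℚ
      0≤K : 0ℚ ≤ K
      0≤K = ≤-trans 0≤1 1≤K
      0≤d : 0ℚ ≤ d
      0≤d = ℚₚ.+-monoˡ-≤ (- 1ℚ) 1≤K
      0≤E : 0ℚ ≤ E
      0≤E = <⇒≤ (*-pos 0<δ 0<δ)
      0<V : 0ℚ < V
      0<V = <-≤-trans (*-pos 0<δ 0<δ) hV
      0≤v : 0ℚ ≤ V - E
      0≤v = subst (_≤ V - E) (ℚₚ.+-inverseʳ E) (ℚₚ.+-monoˡ-≤ (- E) hV)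
      split : T *ᵍ (x -ᵍ a) ≡ A *ᵍ ((x -ᵍ 1ᵍ) *ᵍ F +ᵍ (-ᵍ u)) +ᵍ A *ᵍ ((x -ᵍ 1ᵍ) *ᵍ Π)
      split = trans (obstruction-* k x a)
        (trans (cong (λ z → A *ᵍ (z -ᵍ u)) (sym (fib-sparse k x)))
          (S.solve 5 (λ p x f q u → p S.:* (x S.:* f S.:- u)
            S.:= p S.:* (x S.:* (f S.:- q) S.:+ (S.:- u)) S.:+ p S.:* (x S.:* q)) refl
            A (x -ᵍ 1ᵍ) (fibᵍ k x) Π u))
      firstF : norm ((x -ᵍ 1ᵍ) *ᵍ F) ≤ K * (E * E)
      firstF = subst (_≤ K * (E * E)) (sym (norm-* (x -ᵍ 1ᵍ) F))
        (*-mono (norm-nonNeg (x -ᵍ 1ᵍ)) hx (norm-nonNeg F) (norm-≤ hfx))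
      firstu : norm (-ᵍ u) ≤ K * (E * E)
      firstu = subst (_≤ K * (E * E))
        (sym (trans (norm-neg u) (trans (cong norm (sym (fib-sparse k a))) (norm-* (a -ᵍ 1ᵍ) (fibᵍ k a)))))
        (*-mono (norm-nonNeg (a -ᵍ 1ᵍ)) ha (norm-nonNeg (fibᵍ k a)) (norm-≤ hfa))
      first : norm (A *ᵍ ((x -ᵍ 1ᵍ) *ᵍ F +ᵍ (-ᵍ u))) ≤ R
      first = subst (_≤ R) (sym (norm-* A ((x -ᵍ 1ᵍ) *ᵍ F +ᵍ (-ᵍ u))))
        (*-mono (norm-nonNeg A) hA (norm-nonNeg ((x -ᵍ 1ᵍ) *ᵍ F +ᵍ (-ᵍ u)))
          (≤-trans (norm-+ ((x -ᵍ 1ᵍ) *ᵍ F) (-ᵍ u))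
            (ℚₚ.+-mono-≤ (ℚₚ.+-mono-≤ firstF firstF) (ℚₚ.+-mono-≤ firstu firstu))))
      second : norm (A *ᵍ ((x -ᵍ 1ᵍ) *ᵍ Π)) ≤ K * (K * (V * (E * K)))
      second = subst (_≤ K * (K * (V * (E * K))))
        (sym (trans (norm-* A ((x -ᵍ 1ᵍ) *ᵍ Π)) (cong (norm A *_) (norm-* (x -ᵍ 1ᵍ) Π))))
        (*-mono (norm-nonNeg A) hA (*-nonNeg (norm-nonNeg (x -ᵍ 1ᵍ)) (norm-nonNeg Π))
          (*-mono (norm-nonNeg (x -ᵍ 1ᵍ)) hx (norm-nonNeg Π)
            (≤-trans hΠ (*-monoˡ (norm-nonNeg (x -ᵍ a)) (*-mono (norm-nonNeg (x -ᵍ b)) hxb 0≤K ≤-refl)))))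

  realℂ : ℚ → ℂ
  realℂ q .re = fromℚ q
  realℂ q .im = fromℚ 0ℚ

  abstract
    norm-shift : ∀ w σ → norm (w +ᵍ real σ) ≡ norm w + (σ * ℜ w + σ * ℜ w) + σ * σ
    norm-shift (gauss a b) σ = solve 3 (λ a b s →
      (a :+ s) :* (a :+ s) :+ (b :+ con 0ℚ) :* (b :+ con 0ℚ)
        := a :* a :+ b :* b :+ (s :* a :+ s :* a) :+ s :* s) refl a b σ

    shift-≥ : ∀ a b σ → 0ℚ ≤ σ * ℜ (b -ᵍ a) → σ * σ ≤ norm ((b +ᵍ real σ) -ᵍ a)
    shift-≥ a b σ 0≤ = slack
      (+-nonNeg (norm-nonNeg (b -ᵍ a)) (+-nonNeg 0≤ 0≤))
      (trans (cong norm (S.solve 3 (λ a b s → b S.:+ s S.:- a S.:= b S.:- a S.:+ s) refl a b (real σ)))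
        (trans (norm-shift (b -ᵍ a) σ) (ℚₚ.+-comm _ (σ * σ))))

    shift-norm : ∀ b σ → norm ((b +ᵍ real σ) -ᵍ b) ≡ σ * σ
    shift-norm b σ = trans
      (cong norm (S.solve 2 (λ b s → b S.:+ s S.:- b S.:= s) refl b (real σ))) (norm-real σ)

  diameter : ℚ → ℚ
  diameter B = 1ℚ + 1ℚ + (B + B)

  envelope : ℕ → ℚ → ℚ
  envelope k B = (diameter B * diameter B) ^ k

  module _ {k′ : ℕ} {B δ η : ℚ} (0≤B : 0ℚ ≤ B) (0<δ : 0ℚ < δ) (η≤1 : η ≤ 1ℚ)
           (4KKδ : + 4 / 1 * (envelope (suc k′) B * envelope (suc k′) B) * δ ≡ η) where

    private
      k : ℕ
      k = suc k′

      G C K 4KK : ℚ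
      G = diameter B
      C = G * G
      K = envelope k B
      4KK = + 4 / 1 * (K * K)

    abstract
      private
        1≤G : 1ℚ ≤ G
        1≤G = slack (+-nonNeg 0≤1 (+-nonNeg 0≤B 0≤B))
          (solve 1 (λ b → con 1ℚ :+ con 1ℚ :+ (b :+ b) := con 1ℚ :+ (con 1ℚ :+ (b :+ b))) refl B)
        0≤G : 0ℚ ≤ G
        0≤G = ≤-trans 0≤1 1≤G
        G≤C : G ≤ C
        G≤C = subst (_≤ C) (ℚₚ.*-identityʳ G) (*-monoˡ 0≤G 1≤G)
        1≤C : 1ℚ ≤ C
        1≤C = ≤-trans 1≤G G≤C
        C≤K : C ≤ K
        C≤K = p≤p^ {C} k′ 1≤C
        1≤K : 1ℚ ≤ K
        1≤K = ≤-trans 1≤C C≤K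
        0≤K : 0ℚ ≤ K
        0≤K = ≤-trans 0≤1 1≤K
        K≤4KK : K ≤ 4KK
        K≤4KK = slack (+-nonNeg (*-nonNeg 0≤K (ℚₚ.+-monoˡ-≤ (- 1ℚ) 1≤K)) (*-nonNeg (/-nonNeg 3 0) (*-nonNeg 0≤K 0≤K)))
          (solve 1 (λ K → con (+ 4 / 1) :* (K :* K) := K :+ (K :* (K :- con 1ℚ) :+ con (+ 3 / 1) :* (K :* K))) refl K)
        0≤δ : 0ℚ ≤ δ
        0≤δ = <⇒≤ 0<δ
        δ≤η : δ ≤ η
        δ≤η = subst₂ _≤_ (ℚₚ.*-identityˡ δ) 4KKδ (*-mono 0≤1 (≤-trans 1≤K K≤4KK) 0≤δ ≤-refl)
        δ≤1 : δ ≤ 1ℚ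
        δ≤1 = ≤-trans δ≤η η≤1
        0<E : 0ℚ < δ * δ
        0<E = *-pos 0<δ 0<δ

        widen : ∀ {z r} → z ≼ r → r ≤ G → norm z ≤ C
        widen h r≤G = norm-≤ (≼-mono h r≤G)

    module _ (α : Fin k → ℂ) (i j : Fin k) (i<j : i Fin.< j) (n : ℕ)
             (small : ∀ l → at n (α l) ≼ B)
             (h₁ : at n (fibPoly k (α i)) -ᵍ at n (∏ℂ (λ l → α i -ℂ α l)) ≼ δ * δ) where

      private
        a b : ℚ[i]
        a = at n (α i)
        b = at n (α j)

      abstract
        fib-small : fibᵍ k a ≼ δ * δ
        fib-small = subst (fibᵍ k a ≼_) (ℚₚ.+-identityʳ (δ * δ)) (≼-shift
          (subst₂ (λ y z → y -ᵍ z ≼ δ * δ) (at-fib n k (α i)) (at-∏ n (λ l → α i -ℂ α l)) h₁)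
          (mk≼ ≤-refl (≤-trans
            (norm-∏-≤₁ (λ l → a -ᵍ at n (α l)) 1≤C
              (λ l → widen (≼-minus (small i) (small l))
                (slack {1ℚ + 1ℚ} (/-nonNeg 2 0) (ℚₚ.+-comm (1ℚ + 1ℚ) (B + B)))) i)
            (≤-reflexive (trans (cong (λ z → norm z * K) (S.solve 1 (λ a → a S.:- a S.:= S.con (real 0ℚ)) refl a))
              (ℚₚ.*-zeroˡ K))))))

        a-1 : a -ᵍ 1ᵍ ≼ G
        a-1 = ≼-mono (≼-minus (small i) ≼-1) (slack (+-nonNeg 0≤1 0≤B)
          (solve 1 (λ b → con 1ℚ :+ con 1ℚ :+ (b :+ b) := b :+ con 1ℚ :+ (con 1ℚ :+ b)) refl B))

        sparse-small : sparse k a ≼ η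
        sparse-small = ≼-mono (subst (_≼ G * (δ * δ)) (fib-sparse k a) (≼-* a-1 fib-small))
          (subst (G * (δ * δ) ≤_) (trans (cong (4KK *_) (ℚₚ.*-identityʳ δ)) 4KKδ)
            (*-mono 0≤G (≤-trans G≤C (≤-trans C≤K K≤4KK)) (<⇒≤ 0<E) (*-monoˡ 0≤δ δ≤1)))

        conclude : ∀ σ → σ * σ ≡ δ * δ → 0ℚ ≤ σ * ℜ (b -ᵍ a) →
          at n (fibPoly k (α j +ℂ realℂ σ)) -ᵍ at n (∏ℂ (λ l → (α j +ℂ realℂ σ) -ℂ α l)) ≼ δ * δ →
          ∃ λ x → x -ᵍ b ≼ η × obstruction k x a ≼ η × sparse k a ≼ η
        conclude σ σσ sign h =
          x ,
          ≼-mono x-b δ≤η ,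
          subst (obstruction k x a ≼_) 4KKδ
            (obstruction-small k {K} {δ} {a} {b} {x} {∏ᵍ (λ l → x -ᵍ at n (α l))} 1≤K 0<δ
              (subst (_≤ K) (sym (norm-^ a k)) (^-mono k (norm-nonNeg a) (widen (small i)
                (slack {1ℚ + 1ℚ + B} (+-nonNeg (/-nonNeg 2 0) 0≤B)
                  (solve 1 (λ b → con 1ℚ :+ con 1ℚ :+ (b :+ b) := b :+ (con 1ℚ :+ con 1ℚ :+ b)) refl B)))))
              (≤-trans (widen (≼-minus x≼ ≼-1) (slack 0≤B
                (solve 1 (λ b → con 1ℚ :+ con 1ℚ :+ (b :+ b) := con 1ℚ :+ b :+ con 1ℚ :+ b) refl B))) C≤K)
              (≤-trans (widen a-1 ≤-refl) C≤K)
              (norm-≤ x-b)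
              (subst (_≤ norm (x -ᵍ a)) σσ (shift-≥ a b σ sign))
              fib-small
              (subst₂ (λ y z → y -ᵍ z ≼ δ * δ) (at-fib n k (α j +ℂ realℂ σ))
                (at-∏ n (λ l → (α j +ℂ realℂ σ) -ℂ α l)) h)
              (norm-∏-≤₂ (λ l → x -ᵍ at n (α l)) 1≤C
                (λ l → widen (≼-minus x≼ (small l)) (slack 0≤1
                  (solve 1 (λ b → con 1ℚ :+ con 1ℚ :+ (b :+ b) := con 1ℚ :+ b :+ b :+ con 1ℚ) refl B))) i j i<j)) ,
          sparse-small
          where
          x : ℚ[i]
          x = b +ᵍ real σ
          x-b : x -ᵍ b ≼ δ
          x-b = mk≼ 0≤δ (≤-reflexive (trans (shift-norm b σ) σσ))
          x≼ : x ≼ 1ℚ + B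
          x≼ = ≼-shift {x} {b} (≼-mono x-b δ≤1) (small j)

        choose :
          at n (fibPoly k (α j +ℂ realℂ δ)) -ᵍ at n (∏ℂ (λ l → (α j +ℂ realℂ δ) -ℂ α l)) ≼ δ * δ →
          at n (fibPoly k (α j +ℂ realℂ (- δ))) -ᵍ at n (∏ℂ (λ l → (α j +ℂ realℂ (- δ)) -ℂ α l)) ≼ δ * δ →
          ∃ λ x → x -ᵍ b ≼ η × obstruction k x a ≼ η × sparse k a ≼ η
        choose h₂ h₃ with ℚₚ.≤-total 0ℚ (ℜ (b -ᵍ a))
        ... | inj₁ 0≤ = conclude δ refl (*-nonNeg 0≤δ 0≤) h₂
        ... | inj₂ ≤0 = conclude (- δ) (solve 1 (λ d → (:- d) :* (:- d) := d :* d) refl δ)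
          (subst (0ℚ ≤_) (solve 2 (λ d w → d :* (:- w) := (:- d) :* w) refl δ (ℜ (b -ᵍ a)))
            (*-nonNeg 0≤δ (ℚₚ.neg-antimono-≤ ≤0))) h₃

  abstract
    envelope-≥1 : ∀ {B} k → 0ℚ ≤ B → 1ℚ ≤ envelope k B
    envelope-≥1 {B} k 0≤B = 1≤^ k (*-mono 0≤1 1≤G 0≤1 1≤G)
      where
      1≤G : 1ℚ ≤ diameter B
      1≤G = slack (+-nonNeg 0≤1 (+-nonNeg 0≤B 0≤B))
        (solve 1 (λ b → con 1ℚ :+ con 1ℚ :+ (b :+ b) := con 1ℚ :+ (con 1ℚ :+ (b :+ b))) refl B)

    approach : ∀ {k′} (α : Fin (suc k′) → ℂ) → AreRootsOfFib (suc k′) α →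
      ∀ i j → i Fin.< j → ∀ {η} → 0ℚ < η → η ≤ 1ℚ →
      ∃ λ N → ∀ n → N ℕ.≤ n → ∃ λ x →
        x -ᵍ at n (α j) ≼ η ×
        obstruction (suc k′) x (at n (α i)) ≼ η ×
        sparse (suc k′) (at n (α i)) ≼ η
    approach {k′} α roots i j i<j 0<η η≤1 =
      let B , 0≤B , L , h₀ = uniformly-bounded α
          1≤K = envelope-≥1 (suc k′) 0≤B
          0<K = <-≤-trans 0<1 1≤K
          δ , 0<δ , 4KKδ = scale-bound (+ 4 / 1 * (envelope (suc k′) B * envelope (suc k′) B))
            (*-pos (/-pos 3 0) (*-pos 0<K 0<K)) 0<η
          M , h₁ = ≈ℂ⇒≼ (roots (α i)) (*-pos 0<δ 0<δ)
          N , h₂ = ≈ℂ⇒≼ (roots (α j +ℂ realℂ δ)) (*-pos 0<δ 0<δ)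
          O , h₃ = ≈ℂ⇒≼ (roots (α j +ℂ realℂ (- δ))) (*-pos 0<δ 0<δ)
      in (L ℕ.⊔ M) ℕ.⊔ (N ℕ.⊔ O) , λ n n≥ → choose 0≤B 0<δ η≤1 4KKδ α i j i<j n
           (h₀ n (ℕₚ.m⊔n≤o⇒m≤o L M (ℕₚ.m⊔n≤o⇒m≤o (L ℕ.⊔ M) (N ℕ.⊔ O) n≥)))
           (h₁ n (ℕₚ.m⊔n≤o⇒n≤o L M (ℕₚ.m⊔n≤o⇒m≤o (L ℕ.⊔ M) (N ℕ.⊔ O) n≥)))
           (h₂ n (ℕₚ.m⊔n≤o⇒m≤o N O (ℕₚ.m⊔n≤o⇒n≤o (L ℕ.⊔ M) (N ℕ.⊔ O) n≥)))
           (h₃ n (ℕₚ.m⊔n≤o⇒n≤o N O (ℕₚ.m⊔n≤o⇒n≤o (L ℕ.⊔ M) (N ℕ.⊔ O) n≥)))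

  infix 4 _≤ᵉ_

  record _≤ᵉ_ (c : ℚ) (x : ℝ) : Set where
    constructor mk≤ᵉ
    field
      index : ℕ
      bound : ∀ n → index ℕ.≤ n → c ≤ seq x n

  abstract
    ν≡/ : ∀ n → + n / 1 ≡ ν n
    ν≡/ zero    = refl
    ν≡/ (suc n) = trans (/-suc n 0) (trans (ℚₚ.+-comm (+ n / 1) 1ℚ) (cong (λ z → 1ℚ + z) (ν≡/ n)))

    seq-^ : ∀ x m n → seq (x ^ℝ m) n ≡ seq x n ^ m
    seq-^ x zero    n = refl
    seq-^ x (suc m) n = cong (seq x n *_) (seq-^ x m n)

    -- 21 is the least index at which the tail bound 6 / (n + 1) yields e ≤ 3.
    e≤3 : ∀ n → 21 ℕ.≤ n → eSeq n ≤ + 3 / 1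
    e≤3 n 21≤n = subst (λ i → eSeq i ≤ + 3 / 1) (ℕₚ.m∸n+n≡m 21≤n) (begin
      eSeq (d ℕ.+ 21)                              ≤⟨ slack (/-nonNeg 6 (d ℕ.+ 21)) refl ⟩
      eSeq (d ℕ.+ 21) + + 6 / suc (d ℕ.+ 21)       ≤⟨ eSeq-tail d 21 ⟩
      eSeq 21 + + 6 / 22                           ≤⟨ closed-≤ ⟩
      + 3 / 1                                      ∎)
      where
      open ≤-Reasoning
      d : ℕ
      d = n ℕ.∸ 21

    0<eSeq : ∀ n → 1 ℕ.≤ n → 0ℚ < eSeq n
    0<eSeq n 1≤n = <-≤-trans 0<1
      (subst (λ i → 1ℚ ≤ eSeq i) (ℕₚ.m∸n+n≡m 1≤n) (eSeq-mono (n ℕ.∸ 1) 1))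

    3≤π : ∀ n → 8 ℕ.≤ n → + 3 / 1 ≤ πSeq n
    3≤π n 8≤n = subst (λ i → + 3 / 1 ≤ πSeq i) (ℕₚ.m∸n+n≡m 8≤n)
      (≤-trans (closed-≤ {p = + 3 / 1} {q = πSeq 8})
        (slack (leibnizTail-nonNeg 8 (n ℕ.∸ 8))
          (trans (πSeq-split (n ℕ.∸ 8) 8) (cong (λ z → πSeq 8 + z) (ℚₚ.*-identityˡ (leibnizTail 8 (n ℕ.∸ 8)))))))

    1≤π/e : ∀ n → 21 ℕ.≤ n → 1ℚ ≤ seq π/e n
    1≤π/e n 21≤n = ≤-trans (closed-≤ {p = 1ℚ} {q = + 3 / 1 * recip (+ 3 / 1)})
      (*-mono (/-nonNeg 3 0) (3≤π n (ℕₚ.≤-trans (ℕₚ.m≤m+n 8 13) 21≤n))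
        (<⇒≤ (recip-pos (+ 3 / 1) (/-pos 2 0)))
        (recip-anti (eSeq n) (+ 3 / 1) (0<eSeq n (ℕₚ.≤-trans (ℕₚ.m≤m+n 1 20) 21≤n)) (e≤3 n 21≤n)))

    ^-cancel-≤ : ∀ m {t u v} → 0ℚ ≤ u → 0ℚ ≤ t → (r + t) ^ m ≤ v → v ℚ.⊔ 0ℚ < (u + t) ^ m → r ≤ u
    ^-cancel-≤ m {t} {u} {v} 0≤u 0≤t lower upper = ℚₚ.≮⇒≥ λ u<r → <⇒≱ upper
      (≤-trans (^-mono m (+-nonNeg 0≤u 0≤t) (ℚₚ.+-monoˡ-≤ t (<⇒≤ u<r)))
        (≤-trans lower (ℚₚ.p≤p⊔q v 0ℚ)))

    root-≥ : ∀ m .{{_ : ℕ.NonZero m}} x n → (r + + 1 / suc n) ^ m ≤ seq x n → r ≤ seq (root m x) n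
    root-≥ (suc m) x n lower = ^-cancel-≤ (suc m) {+ 1 / suc n} {rootApprox (suc m) n (seq x n)} {seq x n}
      (rootApprox-nonNeg (suc m) n (seq x n)) (/-nonNeg 1 n) lower (rootApprox-upper m n (seq x n))

    1/suc≤1 : ∀ n → + 1 / suc n ≤ 1ℚ
    1/suc≤1 n = /-mono 1 n 1 0 (s≤s z≤n)

    power-bound : 4ℚ ≤ p → 0ℚ ≤ r → r ≤ 1ℚ → (+ 100 / 1 * (p * p) + r) ^ 5 ≤ p ^ 33
    power-bound {p} {r} 4≤p 0≤r r≤1 = begin
      (+ 100 / 1 * (p * p) + r) ^ 5
        ≤⟨ ^-mono 5 (+-nonNeg (*-nonNeg (/-nonNeg 100 0) (square-nonNeg p)) 0≤r) base ⟩
      (p ^ 6) ^ 5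
        ≡⟨ ^-assocʳ p 6 5 ⟩
      p ^ 30
        ≡⟨ sym (ℚₚ.*-identityˡ (p ^ 30)) ⟩
      1ℚ * p ^ 30
        ≤⟨ *-mono 0≤1 (1≤^ 3 1≤p) (^-nonNeg 30 (≤-trans 0≤1 1≤p)) ≤-refl ⟩
      p ^ 3 * p ^ 30
        ≡⟨ sym (^-homo-* p 3 30) ⟩
      p ^ 33 ∎
      where
      open ≤-Reasoning
      1≤p : 1ℚ ≤ p
      1≤p = ≤-trans (closed-≤ {p = 1ℚ} {q = 4ℚ}) 4≤p
      base : + 100 / 1 * (p * p) + r ≤ p ^ 6
      base = begin
        + 100 / 1 * (p * p) + r
          ≤⟨ ℚₚ.+-monoʳ-≤ (+ 100 / 1 * (p * p)) (≤-trans r≤1 (*-mono 0≤1 1≤p 0≤1 1≤p)) ⟩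
        + 100 / 1 * (p * p) + p * p
          ≡⟨ solve 1 (λ s → con (+ 100 / 1) :* s :+ s := s :* con (+ 101 / 1)) refl (p * p) ⟩
        p * p * (+ 101 / 1)
          ≤⟨ *-monoˡ (square-nonNeg p) (≤-trans (closed-≤ {p = + 101 / 1} {q = 4ℚ ^ 4})
               (^-mono 4 (/-nonNeg 4 0) 4≤p)) ⟩
        p * p * p ^ 4
          ≡⟨ ℚₚ.*-assoc p p (p ^ 4) ⟩
        p ^ 6 ∎

    power-product-≥ : ∀ a b .{{_ : ℕ.NonZero b}} x y k n → 0ℚ ≤ r →
      (r + + 1 / suc n) ^ b ≤ seq x n ^ a → 1ℚ ≤ seq y n → r ≤ seq (x ^[ a / b ] *ℝ y ^ℝ k) n
    power-product-≥ {r} a b x y k n 0≤r h 1≤y =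
      subst (_≤ seq (x ^[ a / b ]) n * seq (y ^ℝ k) n) (ℚₚ.*-identityʳ r)
        (*-mono 0≤r (root-≥ b (x ^ℝ a) n (subst ((r + + 1 / suc n) ^ b ≤_) (sym (seq-^ x a n)) h))
          0≤1 (subst (1ℚ ≤_) (sym (seq-^ y k n)) (1≤^ k 1≤y)))

    modulus-≥ : ∀ z n → (r + + 1 / suc n) ^ 2 ≤ norm (at n z) → r ≤ seq ∣ z ∣ℂ n
    modulus-≥ {r} z n h = subst (λ x → r ≤ seq x n) (modulus z)
      (root-≥ 2 (re z *ℝ re z +ℝ im z *ℝ im z) n h)
      where
      modulus : ∀ z → root 2 (re z *ℝ re z +ℝ im z *ℝ im z) ≡ ∣ z ∣ℂ
      modulus z = refl

  abstract
    seq-fromℕ : ∀ k n → seq (fromℕ k) n ≡ ν k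
    seq-fromℕ k n = ν≡/ k

    -- The exponents are variables because the type checker would unfold literal powers.
    denominator-≥ : ∀ a b .{{_ : ℕ.NonZero b}} k n → 0ℚ ≤ r →
      (r + + 1 / suc n) ^ b ≤ ν k ^ a → 21 ℕ.≤ n → r ≤ seq (fromℕ k ^[ a / b ] *ℝ π/e ^ℝ k) n
    denominator-≥ {r} a b k n 0≤r h 21≤n = power-product-≥ a b (fromℕ k) π/e k n 0≤r
      (subst (λ c → (r + + 1 / suc n) ^ b ≤ c ^ a) (sym (seq-fromℕ k n)) h) (1≤π/e n 21≤n)

    denominator-≤ᵉ : ∀ a b .{{_ : ℕ.NonZero b}} k → 0ℚ ≤ r →
      (r + 1ℚ) ^ b ≤ ν k ^ a → r ≤ᵉ fromℕ k ^[ a / b ] *ℝ π/e ^ℝ k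
    denominator-≤ᵉ {r} a b k 0≤r h = mk≤ᵉ 21 λ n → denominator-≥ a b k n 0≤r
      (≤-trans (^-mono b (+-nonNeg 0≤r (/-nonNeg 1 n)) (ℚₚ.+-monoʳ-≤ r (1/suc≤1 n))) h)

    inv<modulus : ∀ d (0<d : 0ℝ <ℝ d) z c → 0ℚ < c →
      c ≤ᵉ d →
      (∃ λ N → ∀ n → N ℕ.≤ n → + 1 / 40 * (+ 100 / 1 * recip c) * (+ 1 / 40 * (+ 100 / 1 * recip c)) ≤ norm (at n z)) →
      invℝ d 0<d <ℝ ∣ z ∣ℂ
    inv<modulus d 0<d z c 0<c (mk≤ᵉ L large) (N , far) =
      let M , small = archimedean (½ * κ) (0<½* 0<κ)
      in mk<ℝ κ 0<κ (L ℕ.⊔ (M ℕ.⊔ N)) λ n n≥ →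
        let M⊔N≤n = ℕₚ.m⊔n≤o⇒n≤o L (M ℕ.⊔ N) n≥
        in ≤-trans
          (ℚₚ.+-monoˡ-≤ κ (recip-anti c (seq d n) 0<c (large n (ℕₚ.m⊔n≤o⇒m≤o L (M ℕ.⊔ N) n≥))))
          (modulus-≥ z n
            (≤-trans (^-mono 2 (+-nonNeg (+-nonNeg (<⇒≤ 0<κ) (<⇒≤ 0<κ)) (/-nonNeg 1 n))
                (ℚₚ.+-monoʳ-≤ (κ + κ) (<⇒≤ (small n (ℕₚ.m⊔n≤o⇒m≤o M N M⊔N≤n)))))
              (subst (_≤ norm (at n z))
                (solve 1 (λ κ → let t = con (+ 100 / 1) :* κ in
                  con (+ 1 / 40) :* t :* (con (+ 1 / 40) :* t) := (κ :+ κ :+ con ½ :* κ) :* ((κ :+ κ :+ con ½ :* κ) :* con 1ℚ)) refl κ)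
                (far n (ℕₚ.m⊔n≤o⇒n≤o M N M⊔N≤n)))))
      where
      κ : ℚ
      κ = recip c
      0<κ : 0ℚ < κ
      0<κ = recip-pos c 0<c

    no-close-approximation : ∀ m {t a b x} → 0ℚ ≤ t → ν (4 ℕ.+ m) * ν (4 ℕ.+ m) * t ≤ 1ℚ →
      x -ᵍ b ≼ + 1 / 1000 * t → obstruction (4 ℕ.+ m) x a ≼ + 1 / 1000 * t →
      sparse (4 ℕ.+ m) a ≼ + 1 / 1000 * t →
      + 1 / 40 * t * (+ 1 / 40 * t) ≤ norm (a -ᵍ b)
    no-close-approximation m {t} {a} {b} {x} 0≤t κκt≤1 x-b hT hu = ℚₚ.≮⇒≥ λ close →
      no-close-pair m {t} 0≤t κκt≤1 {a} {x}
        (≼-mono (≼-triangle {x} {b} {u = a} x-b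
            (≼-swap {a} {b} (norm-<⇒≼ {+ 1 / 40 * t} {a -ᵍ b} (*-nonNeg (/-nonNeg 1 39) 0≤t) close)))
          (slack (*-nonNeg (/-nonNeg 24 999) 0≤t)
            (solve 1 (λ t → con (+ 1 / 20) :* t
              := con (+ 1 / 1000) :* t :+ con (+ 1 / 40) :* t :+ con (+ 24 / 1000) :* t) refl t)))
        hT hu

    at-minus : ∀ n z w → at n (z -ℂ w) ≡ at n z -ᵍ at n w
    at-minus n z w = refl

    separated-norm : ∀ k → 4 ℕ.≤ k → (α : Fin k → ℂ) → AreRootsOfFib k α → ∀ i j → i Fin.< j →
      ∀ {t} → 0ℚ < t → t ≤ 1ℚ → ν k * ν k * t ≤ 1ℚ →
      ∃ λ N → ∀ n → N ℕ.≤ n → + 1 / 40 * t * (+ 1 / 40 * t) ≤ norm (at n (α i -ℂ α j))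
    separated-norm (suc (suc (suc (suc m)))) (s≤s (s≤s (s≤s (s≤s z≤n)))) α roots i j i<j {t} 0<t t≤1 κκt≤1 =
      let N , h = approach {3 ℕ.+ m} α roots i j i<j {+ 1 / 1000 * t} (*-pos (/-pos 0 999) 0<t)
            (*-mono {+ 1 / 1000} {1ℚ} {t} {1ℚ} (/-nonNeg 1 999) closed-≤ (<⇒≤ 0<t) t≤1)
      in N , λ n n≥ →
        let x , x-b , hT , hu = h n n≥
        in subst (λ z → + 1 / 40 * t * (+ 1 / 40 * t) ≤ norm z) (sym (at-minus n (α i) (α j)))
             (no-close-approximation m {t} {at n (α i)} {at n (α j)} {x} (<⇒≤ 0<t) κκt≤1 x-b hT hu)

    inverse-square : 4ℚ ≤ p → ∃ λ C → 0ℚ < C × C ≡ + 100 / 1 * (p * p) ×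
      0ℚ < + 100 / 1 * recip C × + 100 / 1 * recip C ≤ 1ℚ × p * p * (+ 100 / 1 * recip C) ≤ 1ℚ
    inverse-square {p} 4≤p = C , 0<C , refl , 0<t ,
      subst₂ _≤_ (ℚₚ.*-identityˡ t) ppt≡1 (*-mono 0≤1 1≤pp (<⇒≤ 0<t) ≤-refl) , ≤-reflexive ppt≡1
      where
      C t : ℚ
      C = + 100 / 1 * (p * p)
      t = + 100 / 1 * recip C
      1≤pp : 1ℚ ≤ p * p
      1≤pp = *-mono 0≤1 1≤p 0≤1 1≤p
        where
        1≤p : 1ℚ ≤ p
        1≤p = ≤-trans (closed-≤ {p = 1ℚ} {q = 4ℚ}) 4≤p
      0<C : 0ℚ < C
      0<C = *-pos (/-pos 99 0) (<-≤-trans 0<1 1≤pp)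
      0<t : 0ℚ < t
      0<t = *-pos (/-pos 99 0) (recip-pos C 0<C)
      ppt≡1 : p * p * t ≡ 1ℚ
      ppt≡1 = trans
        (solve 2 (λ s q → s :* (con (+ 100 / 1) :* q) := con (+ 100 / 1) :* s :* q) refl (p * p) (recip C))
        (recip-inverseʳ C 0<C)

    separated : ∀ d (0<d : 0ℝ <ℝ d) z → 4ℚ ≤ p →
      + 100 / 1 * (p * p) ≤ᵉ d →
      (∀ {t} → 0ℚ < t → t ≤ 1ℚ → p * p * t ≤ 1ℚ →
        ∃ λ N → ∀ n → N ℕ.≤ n → + 1 / 40 * t * (+ 1 / 40 * t) ≤ norm (at n z)) →
      invℝ d 0<d <ℝ ∣ z ∣ℂ
    separated d 0<d z 4≤p large far =
      let c , 0<c , c≡ , 0<t , t≤1 , ppt≤1 = inverse-square 4≤p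
      in inv<modulus d 0<d z c 0<c
           (subst (_≤ᵉ d) (sym c≡) large)
           (far 0<t t≤1 ppt≤1)

    roots-separated : ∀ k (4≤k : 4 ℕ.≤ k) (α : Fin k → ℂ) → AreRootsOfFib k α →
      ∀ i j → i Fin.< j →
      invℝ (fromℕ k ^[ 33 / 5 ] *ℝ π/e ^ℝ k) (separationDenominator-pos k 4≤k) <ℝ ∣ α i -ℂ α j ∣ℂ
    roots-separated k 4≤k α roots i j i<j =
      separated {ν k} (fromℕ k ^[ 33 / 5 ] *ℝ π/e ^ℝ k) (separationDenominator-pos k 4≤k) (α i -ℂ α j) 4≤κ
        (denominator-≤ᵉ 33 5 k (*-nonNeg (/-nonNeg 100 0) (square-nonNeg (ν k))) (power-bound 4≤κ 0≤1 ≤-refl))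
        (separated-norm k 4≤k α roots i j i<j)
      where
      4≤κ : 4ℚ ≤ ν k
      4≤κ = subst (λ l → 4ℚ ≤ ν l) (ℕₚ.m+[n∸m]≡n 4≤k) (4≤ν (k ℕ.∸ 4))

open import Data.Fin using (Fin; _<_)
open import Data.Nat using (ℕ; _≤_)
open import Defs using (ℂ; _-ℂ_; ∣_∣ℂ; AreRootsOfFib; fromℕ; _^[_/_]; _*ℝ_; _^ℝ_; π/e; invℝ; _<ℝ_; separationDenominator-pos)

theorem2 : (k : ℕ) (4≤k : 4 ≤ k) (α : Fin k → ℂ) → AreRootsOfFib k α →
    ∀ (i j : Fin k) → i < j →
    invℝ (fromℕ k ^[ 33 / 5 ] *ℝ π/e ^ℝ k) (separationDenominator-pos k 4≤k) <ℝ ∣ α i -ℂ α j ∣ℂ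
theorem2 = Separation.roots-separated
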